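{- There exists an absolute constant $a>0$ such that for all positive integers $g$ and $\Delta\ge 2$ there exists a digraph $D$ of girth at least $g$, with maximum total degree $\Delta(D)\le\Delta$, and with $\chi(D)\ge a\Delta/\log\Delta$. Moreover, for $\Delta$ sufficiently large one may take $a=\frac{1}{15}$.
   Context: Digraphs are loopless. A set $A\subseteq V(D)$ is acyclic if the induced subdigraph $D[A]$ contains no directed cycle. The chromatic number $\chi(D)$ of a digraph $D$ is the minimum integer $k$ such that $V(D)$ can be partitioned into at most $k$ acyclic sets. A cycle in $D$ means a cycle in the underlying undirected graph, and the girth of $D$ is the length of a shortest such cycle. The total degree of a vertex is the number of arcs incident to it, and $\Delta(D)$ is the maximum total degree over all vertices of $D$. $\log$ denotes the natural logarithm. -}

module Defs where

open import Data.Nat as ℕ using (ℕ; zero; suc)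
open import Data.Integer using (+_)
open import Data.Bool using (Bool; true; false; if_then_else_)
open import Data.Fin using (Fin; inject₁; fromℕ)
import Data.Fin as F
open import Data.List using (List; map; allFin)
open import Data.Nat.ListAction using (sum)
open import Data.Product using (Σ; _×_; _,_; ∃)
open import Data.Sum using (_⊎_)
open import Data.Empty using (⊥)
open import Relation.Nullary using (¬_)
open import Relation.Binary.PropositionalEquality using (_≡_; _≢_)
open import Function.Definitions using (Injective)
open import Data.Rational.Unnormalised using (ℚᵘ; mkℚᵘ; 1ℚᵘ; _+_; _*_; _≤_; _/_)

-- A finite loopless digraph on vertex set Fin n, given by its arc relation.
-- Opposite arcs u→v and v→u (digons) are allowed; parallel arcs are not.
record Digraph : Set where
  field
    n        : ℕ
    arc      : Fin n → Fin n → Bool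
    loopless : ∀ v → arc v v ≡ false
open Digraph public

Arc : (D : Digraph) → Fin (n D) → Fin (n D) → Set
Arc D u v = arc D u v ≡ true

indicator : Bool → ℕ
indicator b = if b then 1 else 0

outdeg indeg totdeg : (D : Digraph) → Fin (n D) → ℕ
outdeg D v = sum (map (λ u → indicator (arc D v u)) (allFin (n D)))
indeg  D v = sum (map (λ u → indicator (arc D u v)) (allFin (n D)))
totdeg D v = outdeg D v ℕ.+ indeg D v

MaxDegreeAtMost : Digraph → ℕ → Set
MaxDegreeAtMost D Δ = ∀ v → totdeg D v ℕ.≤ Δ

UAdj : (D : Digraph) → Fin (n D) → Fin (n D) → Set
UAdj D u v = Arc D u v ⊎ Arc D v u

UCycle : (D : Digraph) (m : ℕ) → Set
UCycle D m =
  Σ (Fin (suc (suc (suc m))) → Fin (n D)) λ f →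
    Injective _≡_ _≡_ f ×
    (∀ (i : Fin (suc (suc m))) → UAdj D (f (inject₁ i)) (f (F.suc i))) ×
    UAdj D (f (fromℕ (suc (suc m)))) (f F.zero)

-- A cycle of length 2 in the underlying multigraph: a digon.
Digon : Digraph → Set
Digon D = Σ (Fin (n D)) λ u → Σ (Fin (n D)) λ v → u ≢ v × Arc D u v × Arc D v u

-- girth(D) ≥ g : no underlying cycle of length < g (loops do not exist).
GirthAtLeast : Digraph → ℕ → Set
GirthAtLeast D g =
  (2 ℕ.< g → ¬ Digon D) × (∀ m → 3 ℕ.+ m ℕ.< g → ¬ UCycle D m)

DirCycleIn : (D : Digraph) → (Fin (n D) → Set) → ℕ → Set
DirCycleIn D P m =
  Σ (Fin (suc (suc m)) → Fin (n D)) λ f →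
    Injective _≡_ _≡_ f ×
    (∀ i → P (f i)) ×
    (∀ (i : Fin (suc m)) → Arc D (f (inject₁ i)) (f (F.suc i))) ×
    Arc D (f (fromℕ (suc m))) (f F.zero)

Acyclic : (D : Digraph) → (Fin (n D) → Set) → Set
Acyclic D P = ∀ m → ¬ DirCycleIn D P m

AcyclicColouring : (D : Digraph) → ℕ → Set
AcyclicColouring D k =
  Σ (Fin (n D) → Fin k) λ c → ∀ (j : Fin k) → Acyclic D (λ v → c v ≡ j)

expTerm : ℚᵘ → ℕ → ℚᵘ
expTerm x zero    = 1ℚᵘ
expTerm x (suc k) = expTerm x k * x * mkℚᵘ (+ 1) k   -- times 1/(k+1)

expPartial : ℚᵘ → ℕ → ℚᵘ
expPartial x zero    = 1ℚᵘ
expPartial x (suc N) = expPartial x N + expTerm x (suc N)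

-- exp(x) ≤ Δ, for x ≥ 0 (partial sums increase to exp x)
ExpAtMost : ℚᵘ → ℕ → Set
ExpAtMost x Δ = ∀ N → expPartial x N ≤ (+ Δ / 1)

-- k ≥ a·Δ / log Δ  (for a > 0, Δ ≥ 2), i.e. k ≥ 1 and exp(a·Δ/k) ≤ Δ
AtLeastALogBound : ℚᵘ → ℕ → ℕ → Set
AtLeastALogBound a Δ zero    = ⊥
AtLeastALogBound a Δ (suc k) = ExpAtMost (a * (+ Δ / 1) * mkℚᵘ (+ 1) k) Δ

ChiAtLeastALog : Digraph → ℚᵘ → ℕ → Set
ChiAtLeastALog D a Δ = ∀ k → AcyclicColouring D k → AtLeastALogBound a Δ k

{-# OPTIONS --safe #-}
-- Arcs are chosen greedily, guided by the expectation of a random construction.  Put d = Δ/3.  Every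
-- vertex sends out d arcs; the head of a new arc must have in-degree below 2d and must be far from the
-- tail, which bounds the degrees by 3d and keeps the girth large.  By counting arcs, at least half of
-- the vertices never reach in-degree 2d.
--
-- An acyclic set of rm such vertices, ordered by repeatedly removing sinks, splits into r blocks of size
-- m with no arc from an earlier block to a later one.  The potential Φ is the sum, over all such block
-- systems not yet destroyed by an arc, of (a multiple of) the probability that random further arcs leave
-- them intact.  At every step some admissible head does not increase Φ, so if Φ < 1 initially then no block system
-- survives and every colour class is small.  Counting block systems gives Φ < 1 initially when
-- n/(rm) is of order d/log d; with r = 30 the constant obtained is better than 1/15.  All logarithms are taken to
-- base 21/20, using (1 + 1/q)^t ≥ 21/20 for q = 20t and exp (1/21) ≤ 21/20.
module Submission where

open import Defs
import Data.Nat as ℕ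

-- A union bound over all orderings of an acyclic set of rm vertices would cost about log(rm) per
-- vertex. Since m has to exceed the size of a ball, it grows with the girth, and such a bound would
-- be useless. A fixed number r of blocks costs only about log(4q) per vertex, where n = qm, and q
-- does not depend on the girth. The price is that arcs inside a block are not excluded; together
-- with one block lost to the ball around the tail, (r-1)(r-2)/2 pairs of blocks remain effective,
-- which for r = 30 is still close to r²/2.
--
-- Hence block systems consist of unsaturated vertices: in-degrees only grow, so a vertex
-- unsaturated at the end was below the cap at every step.

module Exponential where

  open import Data.Nat using (ℕ; zero; suc)
  open import Data.Integer using (+_)
  import Data.Nat.Properties as ℕ
  import Data.Integer as ℤ
  import Data.Integer.Properties as ℤ
  open import Data.Rational.Unnormalised
    using (ℚᵘ; mkℚᵘ; 0ℚᵘ; 1ℚᵘ; _+_; _*_; -_; _≤_; _≃_; *≡*; *≤*; nonNegative; Positive)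
  open import Data.Rational.Unnormalised.Properties
  open import Data.Rational.Unnormalised.Solver using (module +-*-Solver)
  open +-*-Solver using (solve; _:+_; _:*_; _:=_; con)
  open import Relation.Binary.PropositionalEquality using (_≡_; refl; sym; trans; cong; cong₂; subst₂)


  -- Fractions with explicit denominators

  ι : ℕ → ℚᵘ
  ι k = mkℚᵘ (+ k) 0

  1/suc : ℕ → ℚᵘ
  1/suc k = mkℚᵘ (+ 1) k

  fraction-≤ : ∀ {a b c d} → a ℕ.* suc d ℕ.≤ c ℕ.* suc b → mkℚᵘ (+ a) b ≤ mkℚᵘ (+ c) d
  fraction-≤ {a} {b} {c} {d} le = *≤* (subst₂ ℤ._≤_ (ℤ.pos-* a (suc d)) (ℤ.pos-* c (suc b)) (ℤ.+≤+ le))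

  fraction-≃ : ∀ {a b c d} → a ℕ.* suc d ≡ c ℕ.* suc b → mkℚᵘ (+ a) b ≃ mkℚᵘ (+ c) d
  fraction-≃ {a} {b} {c} {d} eq = *≡* (trans (sym (ℤ.pos-* a (suc d))) (trans (cong +_ eq) (ℤ.pos-* c (suc b))))

  fraction-* : ∀ a b c d → mkℚᵘ (+ a) b * mkℚᵘ (+ c) d ≡ mkℚᵘ (+ (a ℕ.* c)) (ℕ.pred (suc b ℕ.* suc d))
  fraction-* a b c d = cong (λ z → mkℚᵘ z (ℕ.pred (suc b ℕ.* suc d))) (sym (ℤ.pos-* a c))

  fraction-+ : ∀ a b c d → mkℚᵘ (+ a) b + mkℚᵘ (+ c) d ≡
                           mkℚᵘ (+ (a ℕ.* suc d ℕ.+ c ℕ.* suc b)) (ℕ.pred (suc b ℕ.* suc d))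
  fraction-+ a b c d = cong (λ z → mkℚᵘ z (ℕ.pred (suc b ℕ.* suc d)))
    (trans (cong₂ ℤ._+_ (sym (ℤ.pos-* a (suc d))) (sym (ℤ.pos-* c (suc b)))) (sym (ℤ.pos-+ (a ℕ.* suc d) (c ℕ.* suc b))))

  ι-* : ∀ a b → ι (a ℕ.* b) ≃ ι a * ι b
  ι-* a b = ≃-reflexive (sym (fraction-* a 0 b 0))

  *-monoˡ : ∀ {p q r} → 0ℚᵘ ≤ r → p ≤ q → p * r ≤ q * r
  *-monoˡ {r = r} 0≤r = *-monoˡ-≤-nonNeg r {{nonNegative 0≤r}}

  *-monoʳ : ∀ {p q r} → 0ℚᵘ ≤ r → p ≤ q → r * p ≤ r * q
  *-monoʳ {r = r} 0≤r = *-monoʳ-≤-nonNeg r {{nonNegative 0≤r}}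

  *-nonNeg : ∀ {p q} → 0ℚᵘ ≤ p → 0ℚᵘ ≤ q → 0ℚᵘ ≤ p * q
  *-nonNeg {p} {q} 0≤p 0≤q = ≤-trans (≤-reflexive (≃-sym (*-zeroˡ q))) (*-monoˡ 0≤q 0≤p)

  fraction-nonNeg : ∀ a b → 0ℚᵘ ≤ mkℚᵘ (+ a) b
  fraction-nonNeg a b = fraction-≤ ℕ.z≤n

  -- Partial sums of the exponential series

  expTerm-nonNeg : ∀ {x} → 0ℚᵘ ≤ x → ∀ k → 0ℚᵘ ≤ expTerm x k
  expTerm-nonNeg 0≤x zero    = fraction-nonNeg 1 0
  expTerm-nonNeg 0≤x (suc k) = *-nonNeg (*-nonNeg (expTerm-nonNeg 0≤x k) 0≤x) (fraction-nonNeg 1 k)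

  expTerm-mono : ∀ {x y} → 0ℚᵘ ≤ x → x ≤ y → ∀ k → expTerm x k ≤ expTerm y k
  expTerm-mono 0≤x x≤y zero    = ≤-refl
  expTerm-mono 0≤x x≤y (suc k) = *-monoˡ (fraction-nonNeg 1 k)
    (≤-trans (*-monoˡ 0≤x (expTerm-mono 0≤x x≤y k)) (*-monoʳ (expTerm-nonNeg (≤-trans 0≤x x≤y) k) x≤y))

  expPartial-mono : ∀ {x y} → 0ℚᵘ ≤ x → x ≤ y → ∀ N → expPartial x N ≤ expPartial y N
  expPartial-mono 0≤x x≤y zero    = ≤-refl
  expPartial-mono 0≤x x≤y (suc N) = +-mono-≤ (expPartial-mono 0≤x x≤y N) (expTerm-mono 0≤x x≤y (suc N))

  -- The mean value inequality for x ↦ x^(k+1)/(k+1)!, whose derivative is x^k/k!.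
  expTerm-step : ∀ {x y} → 0ℚᵘ ≤ x → 0ℚᵘ ≤ y → ∀ k →
    expTerm (x + y) (suc k) ≤ expTerm x (suc k) + y * expTerm (x + y) k
  expTerm-step {x} {y} 0≤x 0≤y zero = ≤-reflexive
    (solve 2 (λ x y → con 1ℚᵘ :* (x :+ y) :* con 1ℚᵘ := con 1ℚᵘ :* x :* con 1ℚᵘ :+ y :* con 1ℚᵘ) ≃-refl x y)
  expTerm-step {x} {y} 0≤x 0≤y (suc k) = begin
    t₁ * (x + y) * u
      ≃⟨ solve 4 (λ t x y u → t :* (x :+ y) :* u := t :* x :* u :+ t :* y :* u) ≃-refl t₁ x y u ⟩
    t₁ * x * u + t₁ * y * u
      ≤⟨ +-monoˡ-≤ (t₁ * y * u) (*-monoˡ 0≤u (*-monoˡ 0≤x (expTerm-step 0≤x 0≤y k))) ⟩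
    (s + y * t₀) * x * u + t₁ * y * u
      ≃⟨ solve 6 (λ s y t₀ x u t₁ → (s :+ y :* t₀) :* x :* u :+ t₁ :* y :* u := s :* x :* u :+ y :* (t₀ :* x :+ t₁) :* u) ≃-refl s y t₀ x u t₁ ⟩
    s * x * u + y * (t₀ * x + t₁) * u
      ≤⟨ +-monoʳ-≤ (s * x * u) (*-monoˡ 0≤u (*-monoʳ 0≤y (+-monoˡ-≤ t₁ t₀x≤))) ⟩
    s * x * u + y * (t₁ * ι (suc k) + t₁) * u
      ≃⟨ solve 5 (λ m y t₁ c u → m :+ y :* (t₁ :* c :+ t₁) :* u := m :+ y :* t₁ :* ((c :+ con 1ℚᵘ) :* u)) ≃-refl (s * x * u) y t₁ (ι (suc k)) u ⟩
    s * x * u + y * t₁ * ((ι (suc k) + 1ℚᵘ) * u)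
      ≃⟨ +-congʳ (s * x * u) (*-congˡ {y * t₁} inverse′) ⟩
    s * x * u + y * t₁ * 1ℚᵘ
      ≃⟨ +-congʳ (s * x * u) (*-identityʳ (y * t₁)) ⟩
    s * x * u + y * t₁ ∎
    where
    open ≤-Reasoning
    u = 1/suc (suc k)
    0≤u = fraction-nonNeg 1 (suc k)
    t₀ = expTerm (x + y) k
    t₁ = expTerm (x + y) (suc k)
    s  = expTerm x (suc k)
    inverse : ∀ k → 1/suc k * ι (suc k) ≃ 1ℚᵘ
    inverse k = ≃-trans (≃-reflexive (fraction-* 1 k (suc k) 0))
      (fraction-≃ (trans (ℕ.*-identityʳ _) (trans (ℕ.*-identityˡ (suc k)) (sym (trans (ℕ.*-identityˡ _) (ℕ.*-identityʳ (suc k)))))))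
    inverse′ : (ι (suc k) + 1ℚᵘ) * u ≃ 1ℚᵘ
    inverse′ = ≃-trans (*-comm (ι (suc k) + 1ℚᵘ) u) (≃-trans (*-congˡ {u} ι+1) (inverse (suc k)))
      where
      ι+1 : ι (suc k) + 1ℚᵘ ≃ ι (suc (suc k))
      ι+1 = ≃-reflexive (trans (fraction-+ (suc k) 0 1 0)
        (cong ι (trans (cong (ℕ._+ 1) (ℕ.*-identityʳ (suc k))) (ℕ.+-comm (suc k) 1))))
    0≤x+y : 0ℚᵘ ≤ x + y
    0≤x+y = +-mono-≤ 0≤x 0≤y
    t₀x≤ : t₀ * x ≤ t₁ * ι (suc k)
    t₀x≤ = begin
      t₀ * x                             ≤⟨ *-monoʳ (expTerm-nonNeg 0≤x+y k) (p≤p+q x y {{nonNegative 0≤y}}) ⟩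
      t₀ * (x + y)                       ≃⟨ ≃-sym (*-identityʳ (t₀ * (x + y))) ⟩
      t₀ * (x + y) * 1ℚᵘ                 ≃⟨ *-congˡ {t₀ * (x + y)} (≃-sym (inverse k)) ⟩
      t₀ * (x + y) * (1/suc k * ι (suc k)) ≃⟨ ≃-sym (*-assoc (t₀ * (x + y)) (1/suc k) (ι (suc k))) ⟩
      t₁ * ι (suc k)                     ∎

  -- `expTerm-step` is summed term by term. It pairs the term of index k+1 with the one of index k,
  -- so `shifted` ends one term short on the right; the missing term is non-negative.
  expPartial-step : ∀ {x y} → 0ℚᵘ ≤ x → 0ℚᵘ ≤ y → ∀ N →
    expPartial (x + y) N ≤ expPartial x N + y * expPartial (x + y) N
  expPartial-step {x} {y} 0≤x 0≤y zero    = p≤p+q 1ℚᵘ (y * 1ℚᵘ) {{nonNegative (*-nonNeg 0≤y (fraction-nonNeg 1 0))}}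
  expPartial-step {x} {y} 0≤x 0≤y (suc N) = ≤-trans (shifted N)
    (+-monoʳ-≤ (expPartial x (suc N)) (*-monoʳ 0≤y
      (p≤p+q (expPartial (x + y) N) (expTerm (x + y) (suc N)) {{nonNegative (expTerm-nonNeg (+-mono-≤ 0≤x 0≤y) (suc N))}})))
    where
    shifted : ∀ N → expPartial (x + y) (suc N) ≤ expPartial x (suc N) + y * expPartial (x + y) N
    shifted zero    = ≤-trans (+-monoʳ-≤ 1ℚᵘ (expTerm-step 0≤x 0≤y 0)) (≤-reflexive (≃-sym (+-assoc 1ℚᵘ (expTerm x 1) (y * 1ℚᵘ))))
    shifted (suc N) = ≤-trans (+-mono-≤ (shifted N) (expTerm-step 0≤x 0≤y (suc N)))
      (≤-reflexive (solve 5 (λ p y e t s → p :+ y :* e :+ (t :+ y :* s) := p :+ t :+ y :* (e :+ s)) ≃-refl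
        (expPartial x (suc N)) y (expPartial (x + y) N) (expTerm x (suc (suc N))) (expTerm (x + y) (suc N))))

  expPartial-zero : ∀ e N → expPartial (mkℚᵘ (+ 0) e) N ≃ 1ℚᵘ
  expPartial-zero e zero    = ≃-refl
  expPartial-zero e (suc N) = ≃-trans (+-cong (expPartial-zero e N)
    (≃-trans (*-congʳ {1/suc N} (≃-trans (*-congˡ {expTerm 0/e N} (fraction-≃ {d = 0} refl)) (*-zeroʳ (expTerm 0/e N)))) (*-zeroˡ (1/suc N))))
    (+-identityʳ 1ℚᵘ)
    where 0/e = mkℚᵘ (+ 0) e

  -- exp (L/(e+1)) ≤ (1 + 1/e)^L
  expPartial-power : ∀ e L N → ι (e ℕ.^ L) * expPartial (mkℚᵘ (+ L) e) N ≤ ι (suc e ℕ.^ L)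
  expPartial-power e zero    N = ≤-reflexive (≃-trans (*-identityˡ (expPartial (mkℚᵘ (+ 0) e) N)) (expPartial-zero e N))
  expPartial-power e (suc L) N = begin
    ι (e ℕ.* e ℕ.^ L) * P′
      ≤⟨ *-monoʳ (fraction-nonNeg (e ℕ.* e ℕ.^ L) 0) (expPartial-mono (fraction-nonNeg (suc L) e) (≤-reflexive split) N) ⟩
    ι (e ℕ.* e ℕ.^ L) * A
      ≃⟨ *-congʳ {A} (≃-trans (≃-reflexive (cong ι (ℕ.*-comm e (e ℕ.^ L)))) (ι-* (e ℕ.^ L) e)) ⟩
    ι (e ℕ.^ L) * ι e * A                  ≃⟨ *-assoc (ι (e ℕ.^ L)) (ι e) A ⟩
    ι (e ℕ.^ L) * (ι e * A)                ≤⟨ *-monoʳ (fraction-nonNeg (e ℕ.^ L) 0) eA≤ ⟩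
    ι (e ℕ.^ L) * (ι (suc e) * P)
      ≃⟨ solve 3 (λ a b c → a :* (b :* c) := b :* (a :* c)) ≃-refl (ι (e ℕ.^ L)) (ι (suc e)) P ⟩
    ι (suc e) * (ι (e ℕ.^ L) * P)          ≤⟨ *-monoʳ (fraction-nonNeg (suc e) 0) (expPartial-power e L N) ⟩
    ι (suc e) * ι (suc e ℕ.^ L)            ≃⟨ ≃-sym (ι-* (suc e) (suc e ℕ.^ L)) ⟩
    ι (suc e ℕ.* suc e ℕ.^ L)              ∎
    where
    open ≤-Reasoning
    x = mkℚᵘ (+ L) e
    y = 1/suc e
    P = expPartial x N
    P′ = expPartial (mkℚᵘ (+ suc L) e) N
    A = expPartial (x + y) N
    split : mkℚᵘ (+ suc L) e ≃ x + y
    split = ≃-trans (fraction-≃ (regroup L e)) (≃-reflexive (sym (fraction-+ L e 1 e)))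
      where
      regroup : ∀ L e → suc L ℕ.* suc (ℕ.pred (suc e ℕ.* suc e)) ≡ (L ℕ.* suc e ℕ.+ 1 ℕ.* suc e) ℕ.* suc e
      regroup L e = trans (sym (ℕ.*-assoc (suc L) (suc e) (suc e)))
        (cong (ℕ._* suc e) (trans (ℕ.+-comm (suc e) (L ℕ.* suc e)) (cong (L ℕ.* suc e ℕ.+_) (sym (ℕ.*-identityˡ (suc e))))))
    c = ι (suc e)
    c≃ : c ≃ ι e + 1ℚᵘ
    c≃ = ≃-sym (≃-reflexive (trans (fraction-+ e 0 1 0) (cong ι (trans (cong (ℕ._+ 1) (ℕ.*-identityʳ e)) (ℕ.+-comm e 1)))))
    cy : c * y ≃ 1ℚᵘ
    cy = ≃-trans (≃-reflexive (fraction-* (suc e) 0 1 e))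
      (fraction-≃ (trans (ℕ.*-identityʳ _) (trans (ℕ.*-identityʳ (suc e)) (sym (trans (ℕ.*-identityˡ _) (ℕ.*-identityˡ (suc e)))))))
    -- `expPartial-step` with y = 1/(e+1), multiplied by e+1: the term y·A becomes a single A, which
    -- cancels. Raising L by one thus costs at most a factor (e+1)/e.
    eA≤ : ι e * A ≤ c * P
    eA≤ = +-cancelʳ-≤′ (begin
      ι e * A + A        ≃⟨ solve 2 (λ i a → i :* a :+ a := (i :+ con 1ℚᵘ) :* a) ≃-refl (ι e) A ⟩
      (ι e + 1ℚᵘ) * A    ≃⟨ *-congʳ {A} (≃-sym c≃) ⟩
      c * A
        ≤⟨ *-monoʳ (fraction-nonNeg (suc e) 0) (expPartial-step (fraction-nonNeg L e) (fraction-nonNeg 1 e) N) ⟩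
      c * (P + y * A)    ≃⟨ solve 4 (λ c p y a → c :* (p :+ y :* a) := c :* p :+ c :* y :* a) ≃-refl c P y A ⟩
      c * P + c * y * A  ≃⟨ +-congʳ (c * P) (≃-trans (*-congʳ {A} cy) (*-identityˡ A)) ⟩
      c * P + A          ∎)
      where
      +-cancelʳ-≤′ : ∀ {p q r} → p + r ≤ q + r → p ≤ q
      +-cancelʳ-≤′ {p} {q} {r} le = ≤-trans (≤-reflexive (≃-sym (cancel p r)))
        (≤-trans (+-monoˡ-≤ (- r) le) (≤-reflexive (cancel q r)))
        where
        cancel : ∀ p r → p + r + (- r) ≃ p
        cancel p r = ≃-trans (+-assoc p r _) (≃-trans (+-congʳ p (+-inverseʳ r)) (+-identityʳ p))

  -- Replaces the real logarithm by powers of 1 + 1/e. The instance e = 20 serves large Δ; e = L =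
  -- 1, that is exp(1/2) ≤ 2, serves small Δ.
  ExpAtMost-power : ∀ e L {x Δ} → 0 ℕ.< e → 0ℚᵘ ≤ x → x ≤ mkℚᵘ (+ L) e → suc e ℕ.^ L ℕ.≤ Δ ℕ.* e ℕ.^ L → ExpAtMost x Δ
  ExpAtMost-power e L {x} {Δ} 0<e 0≤x x≤ le N = *-cancelˡ-≤-pos (ι (e ℕ.^ L)) {{positive-ι}} (begin
    ι (e ℕ.^ L) * expPartial x N               ≤⟨ *-monoʳ (fraction-nonNeg (e ℕ.^ L) 0) (expPartial-mono 0≤x x≤ N) ⟩
    ι (e ℕ.^ L) * expPartial (mkℚᵘ (+ L) e) N  ≤⟨ expPartial-power e L N ⟩
    ι (suc e ℕ.^ L)
      ≤⟨ fraction-≤ (ℕ.*-monoˡ-≤ 1 (ℕ.≤-trans le (ℕ.≤-reflexive (ℕ.*-comm Δ (e ℕ.^ L))))) ⟩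
    ι (e ℕ.^ L ℕ.* Δ)                          ≃⟨ ι-* (e ℕ.^ L) Δ ⟩
    ι (e ℕ.^ L) * ι Δ                          ∎)
    where
    open ≤-Reasoning
    positive-ι : Positive (ι (e ℕ.^ L))
    positive-ι with e ℕ.^ L | ℕ.m^n>0 e {{ℕ.>-nonZero 0<e}} L
    ... | suc _ | _ = _

  ratio-≤ : ∀ s Δ k L e → Δ ℕ.* suc e ℕ.≤ L ℕ.* (suc s ℕ.* suc k) → 1/suc s * ι Δ * 1/suc k ≤ mkℚᵘ (+ L) e
  ratio-≤ s Δ k L e le = ≤-trans (≤-reflexive (≃-trans (*-congʳ {1/suc k} (≃-reflexive (fraction-* 1 s Δ 0)))
      (≃-reflexive (fraction-* (1 ℕ.* Δ) (ℕ.pred (suc s ℕ.* 1)) 1 k))))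
    (fraction-≤ (ℕ.≤-trans (ℕ.≤-reflexive (cong (ℕ._* suc e) (trans (ℕ.*-identityʳ _) (ℕ.*-identityˡ Δ))))
      (ℕ.≤-trans le (ℕ.≤-reflexive (cong (λ z → L ℕ.* (z ℕ.* suc k)) (sym (ℕ.*-identityʳ (suc s))))))))

  ratio-nonNeg : ∀ s Δ k → 0ℚᵘ ≤ 1/suc s * ι Δ * 1/suc k
  ratio-nonNeg s Δ k = *-nonNeg (*-nonNeg (fraction-nonNeg 1 s) (fraction-nonNeg Δ 0)) (fraction-nonNeg 1 k)

module Digraphs where

  open import Data.Bool using (Bool; true; false; _∧_; not)
  import Data.Bool as Bool
  open import Data.Bool.Properties using (∧-conicalˡ)
  open import Data.Nat using (ℕ; zero; suc; _+_; _*_; _∸_; _^_; _≤_; _<_; z≤n; s≤s; z<s; _<?_; _≤?_; NonZero)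
  open import Data.Nat.Properties
  open import Data.Nat.DivMod using (_/_; m/n*n≤m; m≡m%n+[m/n]*n; m%n<n)
  open import Data.Nat.Induction using (<-rec)
  open import Data.Nat.ListAction using (sum; product)
  open import Data.Nat.ListAction.Properties using (sum-++; product-++)
  open import Data.Nat.Tactic.RingSolver using (solve-∀)
  open import Data.Fin using (Fin; zero; suc; toℕ; inject₁; fromℕ)
  import Data.Fin as F
  import Data.Fin.Properties as FP
  open import Data.Vec using (Vec; []; _∷_; lookup; _[_]≔_)
  import Data.Vec as Vec
  open import Data.Vec.Properties using (lookup∘update; lookup∘update′; lookup-replicate)
  open import Data.List
    using (List; []; _∷_; map; allFin; length; _++_; concat; concatMap; replicate; cartesianProductWith)
  open import Data.List.Properties
    using (map-tabulate; map-cong; map-∘; map-++; length-++; length-map; length-tabulate; length-replicate)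
  open import Data.List.Membership.Propositional using (_∈_; _∉_)
  open import Data.List.Membership.Propositional.Properties
    using (∈-++⁺ˡ; ∈-++⁺ʳ; ∈-concatMap⁺; ∈-cartesianProductWith⁺; ∈-allFin)
  open import Data.List.Relation.Unary.Any using (here; there)
  import Data.List.Relation.Unary.Any as Any
  open import Data.List.Relation.Unary.All using (All; []; _∷_)
  import Data.List.Relation.Unary.All as All
  import Data.List.Relation.Unary.All.Properties as All
  open import Data.List.Relation.Unary.AllPairs using (AllPairs; []; _∷_)
  import Data.List.Relation.Unary.AllPairs as AllPairs
  import Data.List.Relation.Unary.AllPairs.Properties as AllPairs
  open import Data.Product using (Σ; ∃; _×_; _,_; proj₁; proj₂)
  open import Data.Product.Properties using (≡-dec)
  open import Data.Rational.Unnormalised using (ℚᵘ; 0ℚᵘ)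
  import Data.Rational.Unnormalised as ℚᵘ
  import Data.Rational.Unnormalised.Properties as ℚᵘ
  open import Data.Sum using (_⊎_; inj₁; inj₂)
  import Data.Sum as Sum
  open import Data.Unit using (tt)
  open import Data.Empty using (⊥; ⊥-elim)
  open import Relation.Nullary using (¬_; Dec; yes; no; does; contradiction; ¬?; _×-dec_; _⊎-dec_; _→-dec_)
  open import Relation.Nullary.Decidable using (dec-true; dec-false)
  open import Relation.Binary.Definitions using (tri<; tri≈; tri>)
  open import Relation.Binary.PropositionalEquality
  open import Function using (_∘_; id)
  open import Function.Definitions using (Injective)
  open Exponential

  -- Finite sums and products

  private variable
    A B P Q R : Set

  ∑ ∏ : List A → (A → ℕ) → ℕ
  ∑ xs f = sum (map f xs)
  ∏ xs f = product (map f xs)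

  ∑-cong : ∀ (xs : List A) {f g : A → ℕ} → (∀ x → f x ≡ g x) → ∑ xs f ≡ ∑ xs g
  ∑-cong xs f≡g = cong sum (map-cong f≡g xs)

  ∏-cong : ∀ (xs : List A) {f g : A → ℕ} → (∀ x → f x ≡ g x) → ∏ xs f ≡ ∏ xs g
  ∏-cong xs f≡g = cong product (map-cong f≡g xs)

  ∑-mono : ∀ (xs : List A) {f g : A → ℕ} → (∀ x → f x ≤ g x) → ∑ xs f ≤ ∑ xs g
  ∑-mono []       f≤g = z≤n
  ∑-mono (x ∷ xs) f≤g = +-mono-≤ (f≤g x) (∑-mono xs f≤g)

  +-interchange : ∀ a b c d → (a + b) + (c + d) ≡ (a + c) + (b + d)
  +-interchange = solve-∀

  *-interchange : ∀ a b c d → (a * b) * (c * d) ≡ (a * c) * (b * d)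
  *-interchange = solve-∀

  ^-distribʳ-* : ∀ k x y → (x * y) ^ k ≡ x ^ k * y ^ k
  ^-distribʳ-* zero    x y = refl
  ^-distribʳ-* (suc k) x y = trans (cong (x * y *_) (^-distribʳ-* k x y)) (*-interchange x y (x ^ k) (y ^ k))

  ∑-+ : ∀ (xs : List A) (f g : A → ℕ) → ∑ xs (λ x → f x + g x) ≡ ∑ xs f + ∑ xs g
  ∑-+ []       f g = refl
  ∑-+ (x ∷ xs) f g = trans (cong (f x + g x +_) (∑-+ xs f g)) (+-interchange (f x) (g x) _ _)

  ∏-* : ∀ (xs : List A) (f g : A → ℕ) → ∏ xs (λ x → f x * g x) ≡ ∏ xs f * ∏ xs g
  ∏-* []       f g = refl
  ∏-* (x ∷ xs) f g = trans (cong (f x * g x *_) (∏-* xs f g)) (*-interchange (f x) (g x) _ _)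

  ∏-one : ∀ (xs : List A) → ∏ xs (λ _ → 1) ≡ 1
  ∏-one []       = refl
  ∏-one (x ∷ xs) = trans (+-identityʳ _) (∏-one xs)

  ∏-^ : ∀ (xs : List A) (f : A → ℕ) k → ∏ xs (λ x → f x ^ k) ≡ ∏ xs f ^ k
  ∏-^ []       f k = sym (^-zeroˡ k)
  ∏-^ (x ∷ xs) f k = trans (cong (f x ^ k *_) (∏-^ xs f k)) (sym (^-distribʳ-* k (f x) (∏ xs f)))

  ∑-*ˡ : ∀ (xs : List A) k (f : A → ℕ) → ∑ xs (λ x → k * f x) ≡ k * ∑ xs f
  ∑-*ˡ []       k f = sym (*-zeroʳ k)
  ∑-*ˡ (x ∷ xs) k f = trans (cong (k * f x +_) (∑-*ˡ xs k f)) (sym (*-distribˡ-+ k (f x) _))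

  ∑-*ʳ : ∀ (xs : List A) (f : A → ℕ) k → ∑ xs (λ x → f x * k) ≡ ∑ xs f * k
  ∑-*ʳ xs f k = trans (∑-cong xs (λ x → *-comm (f x) k)) (trans (∑-*ˡ xs k f) (*-comm k _))

  ∑-const : ∀ (xs : List A) k → ∑ xs (λ _ → k) ≡ length xs * k
  ∑-const []       k = refl
  ∑-const (x ∷ xs) k = cong (k +_) (∑-const xs k)

  ∑-allFin-const : ∀ n k → ∑ (allFin n) (λ _ → k) ≡ n * k
  ∑-allFin-const n k = trans (∑-const (allFin n) k) (cong (_* k) (length-tabulate {n = n} id))

  ∑-++ : ∀ (xs ys : List A) (f : A → ℕ) → ∑ (xs ++ ys) f ≡ ∑ xs f + ∑ ys f
  ∑-++ xs ys f = trans (cong sum (map-++ f xs ys)) (sum-++ (map f xs) (map f ys))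

  ∏-++ : ∀ (xs ys : List A) (f : A → ℕ) → ∏ (xs ++ ys) f ≡ ∏ xs f * ∏ ys f
  ∏-++ xs ys f = trans (cong product (map-++ f xs ys)) (product-++ (map f xs) (map f ys))

  ∑-swap : ∀ (xs : List A) (ys : List B) (f : A → B → ℕ) →
           ∑ xs (λ x → ∑ ys (f x)) ≡ ∑ ys (λ y → ∑ xs (λ x → f x y))
  ∑-swap []       ys f = sym (trans (∑-const ys 0) (*-zeroʳ (length ys)))
  ∑-swap (x ∷ xs) ys f = trans (cong (∑ ys (f x) +_) (∑-swap xs ys f)) (sym (∑-+ ys (f x) _))

  ∑-∈ : ∀ {xs : List A} {x} (f : A → ℕ) → x ∈ xs → f x ≤ ∑ xs f
  ∑-∈ f (here refl) = m≤m+n _ _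
  ∑-∈ f (there x∈)  = ≤-trans (∑-∈ f x∈) (m≤n+m _ _)

  ∑-cartesianProductWith : ∀ {C : Set} (_⊕_ : A → B → C) xs ys (f : C → ℕ) →
    ∑ (cartesianProductWith _⊕_ xs ys) f ≡ ∑ xs (λ x → ∑ ys (λ y → f (x ⊕ y)))
  ∑-cartesianProductWith _⊕_ []       ys f = refl
  ∑-cartesianProductWith _⊕_ (x ∷ xs) ys f =
    trans (∑-++ (map (x ⊕_) ys) _ f)
          (cong₂ _+_ (cong sum (sym (map-∘ ys))) (∑-cartesianProductWith _⊕_ xs ys f))

  ∑-allFin-suc : ∀ n (f : Fin (suc n) → ℕ) → ∑ (allFin (suc n)) f ≡ f zero + ∑ (allFin n) (f ∘ suc)
  ∑-allFin-suc n f = cong (λ xs → f zero + sum xs) (trans (map-tabulate suc f) (sym (map-tabulate id (f ∘ suc))))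

  ∏-allFin-suc : ∀ n (f : Fin (suc n) → ℕ) → ∏ (allFin (suc n)) f ≡ f zero * ∏ (allFin n) (f ∘ suc)
  ∏-allFin-suc n f = cong (λ xs → f zero * product xs) (trans (map-tabulate suc f) (sym (map-tabulate id (f ∘ suc))))

  -- First-moment principle: if every element of positive weight had value at least b+1, the
  -- weighted sum would be at least b+1 times the total weight, which exceeds b times it because the
  -- total is positive.
  weighted-pick : ∀ (xs : List A) (w f : A → ℕ) b →
    ∑ xs (λ x → w x * f x) ≤ ∑ xs w * b → 0 < ∑ xs w → ∃ λ x → 0 < w x × f x ≤ b
  weighted-pick {A} xs w f b avg pos with search xs
    where
    search : ∀ ys → (∃ λ x → 0 < w x × f x ≤ b) ⊎ (∑ ys w * suc b ≤ ∑ ys (λ x → w x * f x))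
    search [] = inj₂ z≤n
    search (y ∷ ys) with search ys
    ... | inj₁ found = inj₁ found
    ... | inj₂ le with w y in eq
    ...   | zero = inj₂ le
    ...   | suc k with f y ≤? b
    ...     | yes fy≤b = inj₁ (y , subst (0 <_) (sym eq) z<s , fy≤b)
    ...     | no  fy≰b = inj₂ (≤-trans (≤-reflexive (*-distribʳ-+ (suc b) (suc k) (∑ ys w)))
                                       (+-mono-≤ (*-monoʳ-≤ (suc k) (≰⇒> fy≰b)) le))
  ... | inj₁ found = found
  ... | inj₂ le = contradiction (≤-trans le avg)
                    (<⇒≱ (≤-trans (+-monoˡ-≤ _ pos) (≤-reflexive (sym (*-suc (∑ xs w) b)))))

  -- Built from `indicator` so that sums of these values agree by computation with the degree sums
  -- of a `Digraph`.
  ⟦_⟧ : Dec P → ℕ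
  ⟦ p ⟧ = indicator (does p)

  ⟦⟧≤1 : (p : Dec P) → ⟦ p ⟧ ≤ 1
  ⟦⟧≤1 (yes _) = ≤-refl
  ⟦⟧≤1 (no _)  = z≤n

  ⟦⟧-true : (p : Dec P) → P → ⟦ p ⟧ ≡ 1
  ⟦⟧-true (yes _) _ = refl
  ⟦⟧-true (no ¬p) p = contradiction p ¬p

  ⟦⟧-false : (p : Dec P) → ¬ P → ⟦ p ⟧ ≡ 0
  ⟦⟧-false (yes p) ¬p = contradiction p ¬p
  ⟦⟧-false (no _)  _  = refl

  ⟦⟧-pos : (p : Dec P) → 0 < ⟦ p ⟧ → P
  ⟦⟧-pos (yes p) _ = p

  ⟦⟧-elim : (p : Dec P) (X : ℕ → Set) → (P → X 1) → (¬ P → X 0) → X ⟦ p ⟧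
  ⟦⟧-elim (yes p) X f g = f p
  ⟦⟧-elim (no ¬p) X f g = g ¬p

  ⟦⟧-≤ : ∀ {k} (p : Dec P) → (P → 1 ≤ k) → ⟦ p ⟧ ≤ k
  ⟦⟧-≤ (yes p) f = f p
  ⟦⟧-≤ (no _)  f = z≤n

  ⟦⟧-⊎ : (p : Dec P) (q : Dec Q) (r : Dec R) → (P → Q ⊎ R) → ⟦ p ⟧ ≤ ⟦ q ⟧ + ⟦ r ⟧
  ⟦⟧-⊎ (no _)  q r f = z≤n
  ⟦⟧-⊎ (yes p) q r f with f p
  ... | inj₁ x = ≤-trans (≤-reflexive (sym (⟦⟧-true q x))) (m≤m+n _ _)
  ... | inj₂ y = ≤-trans (≤-reflexive (sym (⟦⟧-true r y))) (m≤n+m _ _)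

  ⟦⟧-mono : (p : Dec P) (q : Dec Q) → (P → Q) → ⟦ p ⟧ ≤ ⟦ q ⟧
  ⟦⟧-mono (no _)  q f = z≤n
  ⟦⟧-mono (yes p) q f = ≤-reflexive (sym (⟦⟧-true q (f p)))

  ∑-zero : ∀ (xs : List A) {f : A → ℕ} → (∀ x → f x ≡ 0) → ∑ xs f ≡ 0
  ∑-zero xs f≡0 = trans (∑-cong xs f≡0) (trans (∑-const xs 0) (*-zeroʳ (length xs)))

  ∑-δ : ∀ n (b : Fin n) → ∑ (allFin n) (λ a → ⟦ b F.≟ a ⟧) ≡ 1
  ∑-δ (suc n) zero    = trans (∑-allFin-suc n (λ a → ⟦ zero F.≟ a ⟧)) (cong suc (∑-zero (allFin n) (λ _ → refl)))
  ∑-δ (suc n) (suc b) = trans (∑-allFin-suc n (λ a → ⟦ suc b F.≟ a ⟧)) (∑-δ n b)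

  ∏-δ : ∀ n (w : Fin n → ℕ) (b : Fin n) → ∏ (allFin n) (λ a → w a ^ ⟦ b F.≟ a ⟧) ≡ w b
  ∏-δ (suc n) w zero    = trans (∏-allFin-suc n (λ a → w a ^ ⟦ zero F.≟ a ⟧))
    (trans (cong₂ _*_ (*-identityʳ (w zero)) (∏-one (allFin n))) (*-identityʳ (w zero)))
  ∏-δ (suc n) w (suc b) = trans (∏-allFin-suc n (λ a → w a ^ ⟦ suc b F.≟ a ⟧))
    (trans (+-identityʳ _)
    (∏-δ n (w ∘ suc) b))

  ∑-δ′ : ∀ n (b : Fin n) → ∑ (allFin n) (λ a → ⟦ a F.≟ b ⟧) ≡ 1
  ∑-δ′ n b = trans (∑-cong (allFin n) (λ a → ≤-antisym (⟦⟧-mono (a F.≟ b) (b F.≟ a) sym)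
                                                       (⟦⟧-mono (b F.≟ a) (a F.≟ b) sym))) (∑-δ n b)

  -- A product over vertices depends on the labelling only through the class sizes; hence all live
  -- block systems contribute the same amount to the initial potential.
  ∏-multiplicity : ∀ {k} (us : List A) (c : A → Fin k) (w : Fin k → ℕ) →
    ∏ us (w ∘ c) ≡ ∏ (allFin k) (λ a → w a ^ ∑ us (λ u → ⟦ c u F.≟ a ⟧))
  ∏-multiplicity {k = k} [] c w = sym (∏-one (allFin k))
  ∏-multiplicity {k = k} (u ∷ us) c w = begin
    w (c u) * ∏ us (w ∘ c)
      ≡⟨ cong₂ _*_ (sym (∏-δ k w (c u))) (∏-multiplicity us c w) ⟩
    ∏ (allFin k) (λ a → w a ^ ⟦ c u F.≟ a ⟧) * ∏ (allFin k) (λ a → w a ^ ∑ us (λ u → ⟦ c u F.≟ a ⟧))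
      ≡⟨ sym (∏-* (allFin k) _ _) ⟩
    ∏ (allFin k) (λ a → w a ^ ⟦ c u F.≟ a ⟧ * w a ^ ∑ us (λ u → ⟦ c u F.≟ a ⟧))
      ≡⟨ ∏-cong (allFin k) (λ a → sym (^-distribˡ-+-* (w a) ⟦ c u F.≟ a ⟧ _)) ⟩
    ∏ (allFin k) (λ a → w a ^ ∑ (u ∷ us) (λ u → ⟦ c u F.≟ a ⟧)) ∎
    where open ≡-Reasoning

  -- Arc lists, balls and girth

  module _ {n : ℕ} where

    -- The newest arc stands at the head, so induction on the list undoes the greedy choices one at
    -- a time.
    Arcs : Set
    Arcs = List (Fin n × Fin n)

    infix 4 _∈?_
    _∈?_ : (e : Fin n × Fin n) (E : Arcs) → Dec (e ∈ E)
    e ∈? E = Any.any? (≡-dec F._≟_ F._≟_ e) E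

    outcount incount : Arcs → Fin n → ℕ
    outcount E x = ∑ E (λ e → ⟦ x F.≟ proj₁ e ⟧)
    incount  E x = ∑ E (λ e → ⟦ x F.≟ proj₂ e ⟧)

    ∑-incount : ∀ E → ∑ (allFin n) (incount E) ≡ length E
    ∑-incount E = trans (∑-swap (allFin n) E _)
      (trans (∑-cong E (λ e → ∑-δ′ n (proj₂ e))) (trans (∑-const E 1) (*-identityʳ _)))

    private
      ∈-split : ∀ (a b u v : Fin n) E →
                ⟦ (u , v) ∈? (a , b) ∷ E ⟧ ≤ ⟦ u F.≟ a ⟧ * ⟦ v F.≟ b ⟧ + ⟦ (u , v) ∈? E ⟧
      ∈-split a b u v E = ⟦⟧-≤ ((u , v) ∈? (a , b) ∷ E) λ
        { (here refl) → ≤-trans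
            (≤-reflexive (sym (cong₂ _*_ (⟦⟧-true (u F.≟ u) refl) (⟦⟧-true (v F.≟ v) refl)))) (m≤m+n _ _)
        ; (there e∈)  → ≤-trans (≤-reflexive (sym (⟦⟧-true ((u , v) ∈? E) e∈))) (m≤n+m _ _) }

    ∑-∈-out : ∀ E u → ∑ (allFin n) (λ v → ⟦ (u , v) ∈? E ⟧) ≤ outcount E u
    ∑-∈-out []            u = ≤-reflexive (∑-zero (allFin n) (λ _ → refl))
    ∑-∈-out ((a , b) ∷ E) u = begin
      ∑ (allFin n) (λ v → ⟦ (u , v) ∈? (a , b) ∷ E ⟧)
        ≤⟨ ∑-mono (allFin n) (λ v → ∈-split a b u v E) ⟩
      ∑ (allFin n) (λ v → ⟦ u F.≟ a ⟧ * ⟦ v F.≟ b ⟧ + ⟦ (u , v) ∈? E ⟧)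
        ≡⟨ ∑-+ (allFin n) _ _ ⟩
      ∑ (allFin n) (λ v → ⟦ u F.≟ a ⟧ * ⟦ v F.≟ b ⟧) + ∑ (allFin n) (λ v → ⟦ (u , v) ∈? E ⟧)
        ≤⟨ +-mono-≤ (≤-reflexive (trans (∑-*ˡ (allFin n) ⟦ u F.≟ a ⟧ _)
                      (trans (cong (⟦ u F.≟ a ⟧ *_) (∑-δ′ n b)) (*-identityʳ _)))) (∑-∈-out E u) ⟩
      outcount ((a , b) ∷ E) u ∎
      where open ≤-Reasoning

    ∑-∈-in : ∀ E v → ∑ (allFin n) (λ u → ⟦ (u , v) ∈? E ⟧) ≤ incount E v
    ∑-∈-in []            v = ≤-reflexive (∑-zero (allFin n) (λ _ → refl))
    ∑-∈-in ((a , b) ∷ E) v = begin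
      ∑ (allFin n) (λ u → ⟦ (u , v) ∈? (a , b) ∷ E ⟧)
        ≤⟨ ∑-mono (allFin n) (λ u → ∈-split a b u v E) ⟩
      ∑ (allFin n) (λ u → ⟦ u F.≟ a ⟧ * ⟦ v F.≟ b ⟧ + ⟦ (u , v) ∈? E ⟧)
        ≡⟨ ∑-+ (allFin n) _ _ ⟩
      ∑ (allFin n) (λ u → ⟦ u F.≟ a ⟧ * ⟦ v F.≟ b ⟧) + ∑ (allFin n) (λ u → ⟦ (u , v) ∈? E ⟧)
        ≤⟨ +-mono-≤ (≤-reflexive (trans (∑-*ʳ (allFin n) _ ⟦ v F.≟ b ⟧)
                      (trans (cong (_* ⟦ v F.≟ b ⟧) (∑-δ′ n a)) (*-identityˡ _)))) (∑-∈-in E v) ⟩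
      incount ((a , b) ∷ E) v ∎
      where open ≤-Reasoning

    Adj : Arcs → Fin n → Fin n → Set
    Adj E u v = (u , v) ∈ E ⊎ (v , u) ∈ E

    data Walk (E : Arcs) : Fin n → Fin n → ℕ → Set where
      []  : ∀ {x} → Walk E x x 0
      _∷_ : ∀ {x y z k} → Adj E x y → Walk E y z k → Walk E x z (suc k)

    _++ʷ_ : ∀ {E x y z j k} → Walk E x y j → Walk E y z k → Walk E x z (j + k)
    []      ++ʷ q = q
    (e ∷ p) ++ʷ q = e ∷ (p ++ʷ q)

    reverseʷ : ∀ {E x y k} → Walk E x y k → Walk E y x k
    reverseʷ [] = []
    reverseʷ {k = suc k} (e ∷ p) = subst (Walk _ _ _) (+-comm k 1) (reverseʷ p ++ʷ (Sum.swap e ∷ []))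

    neighbours : Arcs → Fin n → List (Fin n)
    neighbours []            x = []
    neighbours ((a , b) ∷ E) x with x F.≟ a | x F.≟ b
    ... | yes _ | yes _ = b ∷ a ∷ neighbours E x
    ... | yes _ | no _  = b ∷ neighbours E x
    ... | no _  | yes _ = a ∷ neighbours E x
    ... | no _  | no _  = neighbours E x

    length-neighbours : ∀ E x → length (neighbours E x) ≡ outcount E x + incount E x
    length-neighbours []            x = refl
    length-neighbours ((a , b) ∷ E) x with x F.≟ a | x F.≟ b
    ... | yes _ | yes _ = cong suc (trans (cong suc (length-neighbours E x)) (sym (+-suc _ _)))
    ... | yes _ | no _  = cong suc (length-neighbours E x)
    ... | no _  | yes _ = trans (cong suc (length-neighbours E x)) (sym (+-suc _ _))
    ... | no _  | no _  = length-neighbours E x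

    ∈-neighbours : ∀ E {x y} → Adj E x y → y ∈ neighbours E x
    ∈-neighbours [] (inj₁ ())
    ∈-neighbours [] (inj₂ ())
    ∈-neighbours ((a , b) ∷ E) {x} adj with x F.≟ a | x F.≟ b | adj
    ... | yes _  | yes _  | inj₁ (here refl) = here refl
    ... | yes _  | no _   | inj₁ (here refl) = here refl
    ... | no x≢a | _      | inj₁ (here refl) = contradiction refl x≢a
    ... | yes _  | yes _  | inj₂ (here refl) = there (here refl)
    ... | no _   | yes _  | inj₂ (here refl) = here refl
    ... | _      | no x≢b | inj₂ (here refl) = contradiction refl x≢b
    ... | yes _  | yes _  | inj₁ (there e) = there (there (∈-neighbours E (inj₁ e)))
    ... | yes _  | no _   | inj₁ (there e) = there (∈-neighbours E (inj₁ e))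
    ... | no _   | yes _  | inj₁ (there e) = there (∈-neighbours E (inj₁ e))
    ... | no _   | no _   | inj₁ (there e) = ∈-neighbours E (inj₁ e)
    ... | yes _  | yes _  | inj₂ (there e) = there (there (∈-neighbours E (inj₂ e)))
    ... | yes _  | no _   | inj₂ (there e) = there (∈-neighbours E (inj₂ e))
    ... | no _   | yes _  | inj₂ (there e) = there (∈-neighbours E (inj₂ e))
    ... | no _   | no _   | inj₂ (there e) = ∈-neighbours E (inj₂ e)

    -- Repetitions are harmless, because only an upper bound for the length is wanted. Keeping the
    -- centre at each step lets walks shorter than the radius count as well.
    ball : Arcs → ℕ → Fin n → List (Fin n)
    ball E zero    u = u ∷ []
    ball E (suc k) u = concatMap (ball E k) (u ∷ neighbours E u)

    private
      length-concatMap : ∀ (h : Fin n → List (Fin n)) {s} → (∀ x → length (h x) ≤ s) → ∀ xs →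
                         length (concatMap h xs) ≤ length xs * s
      length-concatMap h le []       = z≤n
      length-concatMap h le (x ∷ xs) = ≤-trans (≤-reflexive (length-++ (h x)))
                                               (+-mono-≤ (le x) (length-concatMap h le xs))

    length-ball : ∀ E {D} → (∀ x → outcount E x + incount E x ≤ D) →
                  ∀ k u → length (ball E k u) ≤ suc D ^ k
    length-ball E deg≤ zero    u = ≤-refl
    length-ball E deg≤ (suc k) u = ≤-trans (length-concatMap (ball E k) (length-ball E deg≤ k) (u ∷ neighbours E u))
      (*-monoˡ-≤ _ (s≤s (≤-trans (≤-reflexive (length-neighbours E u)) (deg≤ u))))

    ∈-ball : ∀ E k {u v j} → Walk E u v j → j ≤ k → v ∈ ball E k u
    ∈-ball E zero []       z≤n = here refl
    ∈-ball E (suc k) {u} [] z≤n = ∈-++⁺ˡ (∈-ball E k {u} [] z≤n)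
    ∈-ball E (suc k) {u} (_∷_ {y = y} e p) (s≤s j≤k) =
      ∈-++⁺ʳ (ball E k u) (∈-concatMap⁺ (ball E k) (Any.map (λ { refl → ∈-ball E k p j≤k }) (∈-neighbours E e)))

    ∑-∈-list : ∀ xs → ∑ (allFin n) (λ v → ⟦ Any.any? (v F.≟_) xs ⟧) ≤ length xs
    ∑-∈-list []       = ≤-reflexive (∑-zero (allFin n) (λ _ → refl))
    ∑-∈-list (x ∷ xs) = begin
      ∑ (allFin n) (λ v → ⟦ Any.any? (v F.≟_) (x ∷ xs) ⟧)
        ≤⟨ ∑-mono (allFin n) (λ v → ⟦⟧-⊎ (Any.any? (v F.≟_) (x ∷ xs)) (v F.≟ x) (Any.any? (v F.≟_) xs) Any.toSum) ⟩
      ∑ (allFin n) (λ v → ⟦ v F.≟ x ⟧ + ⟦ Any.any? (v F.≟_) xs ⟧)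
        ≡⟨ ∑-+ (allFin n) _ _ ⟩
      ∑ (allFin n) (λ v → ⟦ v F.≟ x ⟧) + ∑ (allFin n) (λ v → ⟦ Any.any? (v F.≟_) xs ⟧)
        ≤⟨ +-mono-≤ (≤-reflexive (∑-δ′ n x)) (∑-∈-list xs) ⟩
      suc (length xs) ∎
      where open ≤-Reasoning

    data Sparse (R : ℕ) : Arcs → Set where
      []  : Sparse R []
      _∷_ : ∀ {u v E} → v ∉ ball E R u → Sparse R E → Sparse R ((u , v) ∷ E)

    Sparse-loopless : ∀ {R E} → Sparse R E → ∀ v → (v , v) ∉ E
    Sparse-loopless {R} {_ ∷ E} (far ∷ _) v (here refl) = far (∈-ball E R [] z≤n)
    Sparse-loopless (_ ∷ s) v (there e) = Sparse-loopless s v e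

    -- The older of two opposite arcs is a walk of length one between the ends of the newer one, so
    -- a positive radius forbids it.
    Sparse-nodigon : ∀ {R E} → Sparse (suc R) E → ∀ {u v} → (u , v) ∈ E → (v , u) ∉ E
    Sparse-nodigon s@(_ ∷ _)         (here refl) (here refl) = Sparse-loopless s _ (here refl)
    Sparse-nodigon {R} {_ ∷ E} (far ∷ _) (here refl) (there f) = far (∈-ball E (suc R) (inj₂ f ∷ []) (s≤s z≤n))
    Sparse-nodigon {R} {_ ∷ E} (far ∷ _) (there e) (here refl) = far (∈-ball E (suc R) (inj₂ e ∷ []) (s≤s z≤n))
    Sparse-nodigon (_ ∷ s)           (there e) (there f) = Sparse-nodigon s e f

    Edges : Arcs → ∀ {l} → (Fin (suc l) → Fin n) → Set
    Edges E {l} f = ∀ (i : Fin l) → Adj E (f (inject₁ i)) (f (suc i))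

    Edges⇒Walk : ∀ {E} l (f : Fin (suc l) → Fin n) → Edges E f → Walk E (f zero) (f (fromℕ l)) l
    Edges⇒Walk zero    f es = []
    Edges⇒Walk (suc l) f es = es zero ∷ Edges⇒Walk l (f ∘ suc) (es ∘ suc)

    module NewArc (E : Arcs) (u v : Fin n) where

      New : Fin n → Fin n → Set
      New x y = (x ≡ u × y ≡ v) ⊎ (x ≡ v × y ≡ u)

      old⊎new : ∀ {x y} → Adj ((u , v) ∷ E) x y → Adj E x y ⊎ New x y
      old⊎new (inj₁ (here refl)) = inj₂ (inj₁ (refl , refl))
      old⊎new (inj₁ (there e))   = inj₁ (inj₁ e)
      old⊎new (inj₂ (here refl)) = inj₂ (inj₂ (refl , refl))
      old⊎new (inj₂ (there e))   = inj₁ (inj₂ e)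

      New-common : ∀ {x y x′ y′} → New x y → New x′ y′ → x ≡ x′ ⊎ x ≡ y′
      New-common (inj₁ (refl , refl)) (inj₁ (refl , refl)) = inj₁ refl
      New-common (inj₁ (refl , refl)) (inj₂ (refl , refl)) = inj₂ refl
      New-common (inj₂ (refl , refl)) (inj₁ (refl , refl)) = inj₂ refl
      New-common (inj₂ (refl , refl)) (inj₂ (refl , refl)) = inj₁ refl

      New-sym : ∀ {x y} → New x y → New y x
      New-sym (inj₁ (p , q)) = inj₂ (q , p)
      New-sym (inj₂ (p , q)) = inj₁ (q , p)

      Cut : ∀ {l} → (Fin (suc l) → Fin n) → Set
      Cut {l} f = Σ (Fin l) λ i → New (f (inject₁ i)) (f (suc i)) ×
        Σ ℕ λ a → Σ ℕ λ b → suc (a + b) ≡ l × Walk E (f zero) (f (inject₁ i)) a × Walk E (f (suc i)) (f (fromℕ l)) b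

      -- A path without repeated vertices uses the newest arc at most once, since two uses would
      -- share a vertex. Around that use it falls into two walks along older arcs.
      Edges-cut : ∀ l (f : Fin (suc l) → Fin n) → Injective _≡_ _≡_ f → Edges ((u , v) ∷ E) f →
                  Edges E f ⊎ Cut f
      Edges-cut zero    f inj es = inj₁ λ ()
      Edges-cut (suc l) f inj es with old⊎new (es zero) | Edges-cut l (f ∘ suc) (FP.suc-injective ∘ inj) (es ∘ suc)
      ... | inj₁ e | inj₁ old = inj₁ λ { zero → e ; (suc i) → old i }
      ... | inj₁ e | inj₂ (i , new , a , b , eq , p , q) = inj₂ (suc i , new , suc a , b , cong suc eq , e ∷ p , q)
      ... | inj₂ new | inj₁ old = inj₂ (zero , new , 0 , l , refl , [] , Edges⇒Walk l (f ∘ suc) old)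
      ... | inj₂ new | inj₂ (i , new′ , _) with New-common new new′
      ...   | inj₁ eq = contradiction (inj eq) λ ()
      ...   | inj₂ eq = contradiction (inj eq) λ ()

      New-walk : ∀ {R x y k} → v ∉ ball E R u → New x y → Walk E y x k → k ≤ R → ⊥
      New-walk far (inj₁ (refl , refl)) p k≤R = far (∈-ball E _ (reverseʷ p) k≤R)
      New-walk far (inj₂ (refl , refl)) p k≤R = far (∈-ball E _ p k≤R)

    -- Only the most recently added arc of a short cycle needs to be inspected: the
    -- rest of the cycle is a short walk between its ends.
    Sparse-nocycle : ∀ {R E} → Sparse R E → ∀ k → 2 + k ≤ R → (f : Fin (3 + k) → Fin n) →
      Injective _≡_ _≡_ f → Edges E f → Adj E (f (fromℕ (2 + k))) (f zero) → ⊥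
    Sparse-nocycle [] k _ f inj es _ with es zero
    ... | inj₁ ()
    ... | inj₂ ()
    Sparse-nocycle {R} (_∷_ {u} {v} {E} far s) k k≤R f inj es closing
      with Edges-cut (2 + k) f inj es | old⊎new closing
      where open NewArc E u v
    ... | inj₁ old | inj₁ e = Sparse-nocycle s k k≤R f inj old e
    ... | inj₁ old | inj₂ new = NewArc.New-walk E u v far new (Edges⇒Walk (2 + k) f old) k≤R
    -- The way round: from the far end of the new step to the last vertex, over the closing edge,
    -- and on from the first vertex, of total length 2 + k.
    ... | inj₂ (i , new , a , b , eq , p , q) | inj₁ e =
      NewArc.New-walk E u v far new (q ++ʷ (e ∷ p)) (≤-trans (≤-reflexive (trans (+-comm b (suc a)) eq)) k≤R)
    -- Two uses of the newest arc would share a vertex. At step 0 the last vertex gives the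
    -- contradiction, at a later step the first one; the opposite choice could name a vertex that
    -- really is common to both.
    ... | inj₂ (i , new , _) | inj₂ new′ with i | NewArc.New-common E u v new′ new | NewArc.New-common E u v (NewArc.New-sym E u v new′) new
    ...   | zero  | inj₁ x | _ = contradiction (inj x) λ ()
    ...   | zero  | inj₂ x | _ = contradiction (inj x) λ ()
    ...   | suc i′ | _ | inj₁ x = contradiction (inj x) λ ()
    ...   | suc i′ | _ | inj₂ x = contradiction (inj x) λ ()

  -- The greedy choice of arcs

  configs : ∀ k n → List (Vec (Fin k) n)
  configs k zero    = [] ∷ []
  configs k (suc n) = cartesianProductWith _∷_ (allFin k) (configs k n)

  ∈-configs : ∀ {k n} (c : Vec (Fin k) n) → c ∈ configs k n
  ∈-configs []      = here refl
  ∈-configs (a ∷ c) = ∈-cartesianProductWith⁺ _∷_ (∈-allFin a) (∈-configs c)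

  ∑-configs-∏ : ∀ k n (z : Fin k → ℕ) →
    ∑ (configs k n) (λ c → ∏ (allFin n) (z ∘ lookup c)) ≡ ∑ (allFin k) z ^ n
  ∑-configs-∏ k zero    z = refl
  ∑-configs-∏ k (suc n) z = begin
    ∑ (configs k (suc n)) (λ c → ∏ (allFin (suc n)) (z ∘ lookup c))
      ≡⟨ ∑-cartesianProductWith _∷_ (allFin k) (configs k n) _ ⟩
    ∑ (allFin k) (λ a → ∑ (configs k n) (λ c → ∏ (allFin (suc n)) (z ∘ lookup (a ∷ c))))
      ≡⟨ ∑-cong (allFin k) (λ a → trans (∑-cong (configs k n) (λ c → ∏-allFin-suc n (z ∘ lookup (a ∷ c))))
                                        (∑-*ˡ (configs k n) (z a) _)) ⟩
    ∑ (allFin k) (λ a → z a * ∑ (configs k n) (λ c → ∏ (allFin n) (z ∘ lookup c)))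
      ≡⟨ ∑-*ʳ (allFin k) z _ ⟩
    ∑ (allFin k) z * ∑ (configs k n) (λ c → ∏ (allFin n) (z ∘ lookup c))
      ≡⟨ cong (∑ (allFin k) z *_) (∑-configs-∏ k n z) ⟩
    ∑ (allFin k) z ^ suc n ∎
    where open ≡-Reasoning

  count : ∀ {k n} → Fin k → Vec (Fin k) n → ℕ
  count {n = n} a c = ∑ (allFin n) (λ u → ⟦ lookup c u F.≟ a ⟧)

  ∑-count : ∀ {k n} (c : Vec (Fin k) n) → ∑ (allFin k) (λ a → count a c) ≡ n
  ∑-count {k} {n} c = trans (∑-swap (allFin k) (allFin n) _)
    (trans (∑-cong (allFin n) (λ u → ∑-δ k (lookup c u)))
    (trans (∑-allFin-const n 1) (*-identityʳ n)))

  above : ∀ {k} → Fin k → ℕ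
  above {k} a = ∑ (allFin k) (λ b → ⟦ toℕ a <? toℕ b ⟧)

  -- One block is given away to the vertices that are too close to the tail of the new arc.
  penalty : ∀ {r} → Fin (suc r) → ℕ
  penalty zero        = 0
  penalty a@(suc _)   = above a ∸ 1

  -- The same `m` is the block size and the bound for balls of radius `R`, so the heads excluded for
  -- being near make up at most one block. With `n ≡ q * m`, one block is exactly the fraction 1/q
  -- of all vertices.
  module Greedy (n d r m q R : ℕ) (n≡qm : n ≡ q * m) (2m<n : 2 * m < n) (0<d : 0 < d)
                (ball≤m : suc (3 * d) ^ R ≤ m) where

    Config : Set
    Config = Vec (Fin (suc r)) n

    -- weight a / q bounds the probability that a random arc leaving block a does not enter a later block.
    weight : Fin (suc r) → ℕ
    weight a = q ∸ penalty a

    -- Blocks are numbered in the order in which sinks are removed, so an arc between them may lead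
    -- only to its own block or to an earlier one. An end with letter 0 imposes nothing.
    Forward : Config → Fin n × Fin n → Set
    Forward c (u , v) = ¬ (0 < toℕ (lookup c u) × toℕ (lookup c u) < toℕ (lookup c v))

    Unsaturated : Arcs {n} → Fin n → Set
    Unsaturated E v = incount E v < 2 * d

    -- Letter 0 marks the vertices outside the blocks 1, …, r.
    Alive : Arcs → Config → Set
    Alive E c = (∀ i → count (suc i) c ≡ m) × (∀ u → lookup c u ≡ zero ⊎ Unsaturated E u) × All (Forward c) E

    abstract
      alive? : ∀ E c → Dec (Alive E c)
      alive? E c = FP.all? (λ i → count (suc i) c ℕ.≟ m)
        ×-dec FP.all? (λ u → (lookup c u F.≟ zero) ⊎-dec (incount E u <? 2 * d))
        ×-dec All.all? (λ e → ¬? ((0 <? _) ×-dec (_ <? _))) E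

    Alive-tail : ∀ {e E c} → Alive (e ∷ E) c → Alive E c
    Alive-tail (sizes , unsat , _ ∷ fwd) = sizes , Sum.map₂ (≤-trans (s≤s (m≤n+m _ _))) ∘ unsat , fwd

    -- `S` holds the tails of the arcs still to be chosen. Each contributes q times a probability
    -- bound, so the threshold 1 for the expected number of survivors becomes `q ^ length S`.
    Φ : Arcs → List (Fin n) → ℕ
    Φ E S = ∑ (configs (suc r) n) (λ c → ⟦ alive? E c ⟧ * ∏ S (weight ∘ lookup c))

    -- `out≤` and `size≤` count the scheduled arcs too, so a step moves one unit from the schedule
    -- to the arc list and leaves both totals unchanged.
    record Invariant (E : Arcs) (S : List (Fin n)) : Set where
      field
        in≤    : ∀ v → incount E v ≤ 2 * d
        out≤   : ∀ u → outcount E u + ∑ S (λ x → ⟦ u F.≟ x ⟧) ≤ d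
        size≤  : length E + length S ≤ n * d
        sparse : Sparse R E
    open Invariant

    unsaturated : Arcs → ℕ
    unsaturated E = ∑ (allFin n) (λ v → ⟦ incount E v <? 2 * d ⟧)

    -- A saturated vertex absorbs at least 2d arcs, and there are at most nd arcs in all.
    unsaturated-≥ : ∀ {E S} → Invariant E S → n ≤ 2 * unsaturated E
    unsaturated-≥ {E} {S} inv = *-cancelʳ-≤ n (2 * U) d {{ℕ.>-nonZero 0<d}} (+-cancelʳ-≤ (n * d) _ _ (begin
      n * d + n * d
        ≡⟨ trans (double n d) (sym (∑-allFin-const n (2 * d))) ⟩
      ∑ (allFin n) (λ _ → 2 * d)
        ≤⟨ ∑-mono (allFin n) pointwise ⟩
      ∑ (allFin n) (λ v → 2 * d * ⟦ incount E v <? 2 * d ⟧ + incount E v)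
        ≡⟨ ∑-+ (allFin n) _ _ ⟩
      ∑ (allFin n) (λ v → 2 * d * ⟦ incount E v <? 2 * d ⟧) + ∑ (allFin n) (incount E)
        ≡⟨ cong₂ _+_ (∑-*ˡ (allFin n) (2 * d) _) (∑-incount E) ⟩
      2 * d * U + length E
        ≤⟨ +-mono-≤ (≤-reflexive (rearrange d U)) (≤-trans (m≤m+n _ _) (size≤ inv)) ⟩
      2 * U * d + n * d ∎))
      where
      open ≤-Reasoning
      U = unsaturated E
      double : ∀ n d → n * d + n * d ≡ n * (2 * d)
      double = solve-∀
      rearrange : ∀ d U → 2 * d * U ≡ 2 * U * d
      rearrange = solve-∀
      pointwise : ∀ v → 2 * d ≤ 2 * d * ⟦ incount E v <? 2 * d ⟧ + incount E v
      pointwise v = ⟦⟧-elim (incount E v <? 2 * d) (λ b → 2 * d ≤ 2 * d * b + incount E v)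
        (λ _ → ≤-trans (≤-reflexive (sym (*-identityʳ (2 * d)))) (m≤m+n _ _))
        (λ ≮ → ≤-trans (≮⇒≥ ≮) (m≤n+m _ _))

    module Step {E : Arcs} {u : Fin n} {S : List (Fin n)} (inv : Invariant E (u ∷ S)) where

      near? : ∀ v → Dec (v ∈ ball E R u)
      near? v = Any.any? (v F.≟_) (ball E R u)

      Ok : Fin n → Set
      Ok v = Unsaturated E v × v ∉ ball E R u

      ok? : ∀ v → Dec (Ok v)
      ok? v = (incount E v <? 2 * d) ×-dec ¬? (near? v)

      options : ℕ
      options = ∑ (allFin n) (λ v → ⟦ ok? v ⟧)

      near≤m : ∑ (allFin n) (λ v → ⟦ near? v ⟧) ≤ m
      near≤m = ≤-trans (∑-∈-list (ball E R u)) (≤-trans (length-ball E deg≤ R u) ball≤m)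
        where
        deg≤ : ∀ x → outcount E x + incount E x ≤ 3 * d
        deg≤ x = +-mono-≤ (≤-trans (m≤m+n _ _) (out≤ inv x)) (in≤ inv x)

      ok⊎near : ∀ {v} → Unsaturated E v → Ok v ⊎ v ∈ ball E R u
      ok⊎near {v} unsat with near? v
      ... | yes near = inj₂ near
      ... | no  far  = inj₁ (unsat , far)

      -- At least n/2 > m heads are unsaturated, and at most m vertices are near the tail.
      options>0 : 0 < options
      options>0 = *-cancelˡ-< 2 0 options (+-cancelʳ-< (2 * m) 0 (2 * options) (begin-strict
        2 * m  <⟨ 2m<n ⟩
        n      ≤⟨ unsaturated-≥ inv ⟩
        2 * unsaturated E
          ≤⟨ *-monoʳ-≤ 2 (∑-mono (allFin n) (λ v → ⟦⟧-⊎ (incount E v <? 2 * d) (ok? v) (near? v) ok⊎near)) ⟩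
        2 * ∑ (allFin n) (λ v → ⟦ ok? v ⟧ + ⟦ near? v ⟧)
          ≡⟨ trans (cong (2 *_) (∑-+ (allFin n) _ _)) (*-distribˡ-+ 2 options _) ⟩
        2 * options + 2 * ∑ (allFin n) (λ v → ⟦ near? v ⟧)
          ≤⟨ +-monoʳ-≤ (2 * options) (*-monoʳ-≤ 2 near≤m) ⟩
        2 * options + 2 * m ∎))
        where open ≤-Reasoning

      options≤n : options ≤ n
      options≤n = ≤-trans (∑-mono (allFin n) (λ v → ⟦⟧≤1 (ok? v)))
        (≤-reflexive (trans (∑-allFin-const n 1) (*-identityʳ n)))

      survivors : Config → ℕ
      survivors c = ∑ (allFin n) (λ v → ⟦ ok? v ⟧ * ⟦ alive? ((u , v) ∷ E) c ⟧)

      survivors≤options : ∀ c → survivors c ≤ options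
      survivors≤options c = ∑-mono (allFin n) λ v →
        ≤-trans (*-monoʳ-≤ ⟦ ok? v ⟧ (⟦⟧≤1 (alive? ((u , v) ∷ E) c))) (≤-reflexive (*-identityʳ _))

      blocks-above : ∀ {c} → Alive E c → ∀ (a : Fin (suc r)) → above a * m ≤ ∑ (allFin n) (λ v → ⟦ toℕ a <? toℕ (lookup c v) ⟧)
      blocks-above {c} (sizes , _) a = begin
        above a * m
          ≡⟨ sym (∑-*ʳ (allFin (suc r)) (λ b → ⟦ toℕ a <? toℕ b ⟧) m) ⟩
        ∑ (allFin (suc r)) (λ b → ⟦ toℕ a <? toℕ b ⟧ * m)
          ≤⟨ ∑-mono (allFin (suc r)) size ⟩
        ∑ (allFin (suc r)) (λ b → ⟦ toℕ a <? toℕ b ⟧ * count b c)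
          ≡⟨ ∑-cong (allFin (suc r)) (λ b → sym (∑-*ˡ (allFin n) ⟦ toℕ a <? toℕ b ⟧ _)) ⟩
        ∑ (allFin (suc r)) (λ b → ∑ (allFin n) (λ v → ⟦ toℕ a <? toℕ b ⟧ * ⟦ lookup c v F.≟ b ⟧))
          ≡⟨ ∑-swap (allFin (suc r)) (allFin n) _ ⟩
        ∑ (allFin n) (λ v → ∑ (allFin (suc r)) (λ b → ⟦ toℕ a <? toℕ b ⟧ * ⟦ lookup c v F.≟ b ⟧))
          ≤⟨ ∑-mono (allFin n) (λ v → ≤-trans (∑-mono (allFin (suc r)) (only (lookup c v)))
               (≤-reflexive (trans (∑-*ˡ (allFin (suc r)) ⟦ toℕ a <? toℕ (lookup c v) ⟧ _)
                  (trans (cong (⟦ toℕ a <? toℕ (lookup c v) ⟧ *_) (∑-δ (suc r) (lookup c v))) (*-identityʳ _))))) ⟩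
        ∑ (allFin n) (λ v → ⟦ toℕ a <? toℕ (lookup c v) ⟧) ∎
        where
        open ≤-Reasoning
        size : ∀ b → ⟦ toℕ a <? toℕ b ⟧ * m ≤ ⟦ toℕ a <? toℕ b ⟧ * count b c
        size zero    = ≤-trans (≤-reflexive (cong (_* m) (⟦⟧-false (toℕ a <? 0) λ ()))) z≤n
        size (suc i) = ≤-reflexive (cong (⟦ toℕ a <? suc (toℕ i) ⟧ *_) (sym (sizes i)))
        only : ∀ b′ b → ⟦ toℕ a <? toℕ b ⟧ * ⟦ b′ F.≟ b ⟧ ≤ ⟦ toℕ a <? toℕ b′ ⟧ * ⟦ b′ F.≟ b ⟧
        only b′ b with b′ F.≟ b
        ... | yes refl = ≤-refl
        ... | no _     = ≤-reflexive (trans (*-zeroʳ ⟦ toℕ a <? toℕ b ⟧) (sym (*-zeroʳ ⟦ toℕ a <? toℕ b′ ⟧)))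

      -- Every available target in a later block kills c, and at most m vertices are unavailable for being close to u.
      survivors-penalty : ∀ {c} → Alive E c → ∀ a → lookup c u ≡ a → survivors c + penalty a * m ≤ options
      survivors-penalty {c} _ zero _ = ≤-trans (≤-reflexive (+-identityʳ _)) (survivors≤options c)
      survivors-penalty {c} alive@(_ , unsat , _) a@(suc _) eq = begin
        survivors c + (above a ∸ 1) * m
          ≡⟨ cong (survivors c +_) (trans (*-distribʳ-∸ m (above a) 1) (cong (above a * m ∸_) (*-identityˡ m))) ⟩
        survivors c + (above a * m ∸ m) ≤⟨ split (≤-total m (above a * m)) ⟩
        options ∎
        where
        open ≤-Reasoning
        -- A vertex of a later block is unsaturated because `c` is alive, hence it is admissible or
        -- near. As a head it kills `c`, so it adds nothing to the survivors.
        pointwise : ∀ v → ⟦ ok? v ⟧ * ⟦ alive? ((u , v) ∷ E) c ⟧ + ⟦ toℕ a <? toℕ (lookup c v) ⟧ ≤ ⟦ ok? v ⟧ + ⟦ near? v ⟧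
        pointwise v = ⟦⟧-elim (toℕ a <? toℕ (lookup c v))
          (λ b → ⟦ ok? v ⟧ * ⟦ alive? ((u , v) ∷ E) c ⟧ + b ≤ ⟦ ok? v ⟧ + ⟦ near? v ⟧)
          (λ a<cv → ≤-trans (≤-reflexive (cong (λ x → ⟦ ok? v ⟧ * x + 1) (⟦⟧-false (alive? ((u , v) ∷ E) c) (dead a<cv))))
               (≤-trans (≤-reflexive (cong (_+ 1) (*-zeroʳ ⟦ ok? v ⟧)))
                        (⟦⟧-⊎ (yes a<cv) (ok? v) (near? v) λ _ → ok⊎near (unsat-v a<cv (unsat v)))))
          (λ _ → ≤-trans (≤-reflexive (+-identityʳ _))
               (≤-trans (*-monoʳ-≤ ⟦ ok? v ⟧ (⟦⟧≤1 (alive? ((u , v) ∷ E) c)))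
               (≤-trans (≤-reflexive (*-identityʳ ⟦ ok? v ⟧)) (m≤m+n ⟦ ok? v ⟧ _))))
          where
          dead : toℕ a < toℕ (lookup c v) → ¬ Alive ((u , v) ∷ E) c
          dead a<cv (_ , _ , fwd ∷ _) = fwd (subst (λ b → 0 < toℕ b × toℕ b < toℕ (lookup c v)) (sym eq) (z<s , a<cv))
          unsat-v : toℕ a < toℕ (lookup c v) → lookup c v ≡ zero ⊎ Unsaturated E v → Unsaturated E v
          unsat-v _ (inj₂ x) = x
          unsat-v a<cv (inj₁ cv≡0) = contradiction (subst (λ b → toℕ a < toℕ b) cv≡0 a<cv) λ ()
        total : survivors c + above a * m ≤ options + m
        total = begin
          survivors c + above a * m
            ≤⟨ +-monoʳ-≤ (survivors c) (blocks-above {c} alive a) ⟩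
          survivors c + ∑ (allFin n) (λ v → ⟦ toℕ a <? toℕ (lookup c v) ⟧)
            ≡⟨ sym (∑-+ (allFin n) _ _) ⟩
          ∑ (allFin n) (λ v → ⟦ ok? v ⟧ * ⟦ alive? ((u , v) ∷ E) c ⟧ + ⟦ toℕ a <? toℕ (lookup c v) ⟧)
            ≤⟨ ∑-mono (allFin n) pointwise ⟩
          ∑ (allFin n) (λ v → ⟦ ok? v ⟧ + ⟦ near? v ⟧)
            ≡⟨ ∑-+ (allFin n) _ _ ⟩
          options + ∑ (allFin n) (λ v → ⟦ near? v ⟧)
            ≤⟨ +-monoʳ-≤ options near≤m ⟩
          options + m ∎
        -- When the blocks above hold at most `m` vertices, the truncated difference is 0 and the
        -- trivial bound suffices.
        split : m ≤ above a * m ⊎ above a * m ≤ m → survivors c + (above a * m ∸ m) ≤ options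
        split (inj₁ m≤) = ≤-trans (≤-reflexive (sym (+-∸-assoc (survivors c) m≤))) (m≤n+o⇒m∸n≤o _ m (≤-trans total (≤-reflexive (+-comm options m))))
        split (inj₂ ≥m) = ≤-trans (≤-reflexive (trans (cong (survivors c +_) (m≤n⇒m∸n≡0 ≥m)) (+-identityʳ _))) (survivors≤options c)

      -- At least p·m of the admissible heads destroy a live `c`. As there are at most n = qm such
      -- heads, this is at least the fraction p/q of them. A dead system is not revived by any head.
      survivors-weight : ∀ c → survivors c * q ≤ options * (⟦ alive? E c ⟧ * weight (lookup c u))
      survivors-weight c = ⟦⟧-elim (alive? E c) (λ b → survivors c * q ≤ options * (b * weight (lookup c u)))
        (λ alive → begin
          survivors c * q            ≤⟨ m+n≤o⇒m≤o∸n (survivors c * q) (bound alive) ⟩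
          options * q ∸ options * p  ≡⟨ sym (*-distribˡ-∸ options q p) ⟩
          options * (q ∸ p)          ≡⟨ cong (options *_) (sym (*-identityˡ (q ∸ p))) ⟩
          options * (1 * (q ∸ p))    ∎)
        (λ dead → ≤-trans (≤-reflexive (cong (_* q) (∑-zero (allFin n) λ v →
          trans (cong (⟦ ok? v ⟧ *_) (⟦⟧-false (alive? ((u , v) ∷ E) c) (dead ∘ Alive-tail {c = c})))
                (*-zeroʳ ⟦ ok? v ⟧)))) z≤n)
        where
        open ≤-Reasoning
        p = penalty (lookup c u)
        rearrange : ∀ s p m q → s * q + q * m * p ≡ (s + p * m) * q
        rearrange = solve-∀
        bound : Alive E c → survivors c * q + options * p ≤ options * q
        bound alive = begin
          survivors c * q + options * p
            ≤⟨ +-monoʳ-≤ (survivors c * q) (*-monoˡ-≤ p (≤-trans options≤n (≤-reflexive n≡qm))) ⟩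
          survivors c * q + q * m * p
            ≡⟨ rearrange (survivors c) p m q ⟩
          (survivors c + p * m) * q
            ≤⟨ *-monoˡ-≤ q (survivors-penalty {c} alive (lookup c u) refl) ⟩
          options * q ∎

      average : ∑ (allFin n) (λ v → ⟦ ok? v ⟧ * (Φ ((u , v) ∷ E) S * q)) ≤ options * Φ E (u ∷ S)
      average = begin
        ∑ (allFin n) (λ v → ⟦ ok? v ⟧ * (Φ ((u , v) ∷ E) S * q))
          ≡⟨ ∑-cong (allFin n) (λ v → trans (sym (*-assoc ⟦ ok? v ⟧ (Φ ((u , v) ∷ E) S) q))
               (trans (cong (_* q) (sym (∑-*ˡ Cs ⟦ ok? v ⟧ _))) (sym (∑-*ʳ Cs _ q)))) ⟩
        ∑ (allFin n) (λ v → ∑ Cs (λ c → ⟦ ok? v ⟧ * (⟦ alive? ((u , v) ∷ E) c ⟧ * W c) * q))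
          ≡⟨ ∑-swap (allFin n) Cs _ ⟩
        ∑ Cs (λ c → ∑ (allFin n) (λ v → ⟦ ok? v ⟧ * (⟦ alive? ((u , v) ∷ E) c ⟧ * W c) * q))
          ≡⟨ ∑-cong Cs (λ c → trans (∑-cong (allFin n) (λ v → regroup ⟦ ok? v ⟧ ⟦ alive? ((u , v) ∷ E) c ⟧ (W c) q))
                                    (trans (∑-*ʳ (allFin n) _ (q * W c)) (sym (*-assoc (survivors c) q (W c))))) ⟩
        ∑ Cs (λ c → survivors c * q * W c)
          ≤⟨ ∑-mono Cs (λ c → *-monoˡ-≤ (W c) (survivors-weight c)) ⟩
        ∑ Cs (λ c → options * (⟦ alive? E c ⟧ * weight (lookup c u)) * W c)
          ≡⟨ trans (∑-cong Cs (λ c → regroup′ options ⟦ alive? E c ⟧ (weight (lookup c u)) (W c))) (∑-*ˡ Cs options _) ⟩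
        options * Φ E (u ∷ S) ∎
        where
        open ≤-Reasoning
        Cs = configs (suc r) n
        W : Config → ℕ
        W c = ∏ S (weight ∘ lookup c)
        regroup : ∀ a b w q → a * (b * w) * q ≡ a * b * (q * w)
        regroup = solve-∀
        regroup′ : ∀ o a b w → o * (a * b) * w ≡ o * (a * (b * w))
        regroup′ = solve-∀

      extend : ∀ v → Ok v → Invariant ((u , v) ∷ E) S
      extend v (unsat , far) = record
        { in≤    = in≤′
        ; out≤   = λ x → ≤-trans (≤-reflexive (shuffle ⟦ x F.≟ u ⟧ (outcount E x) _)) (out≤ inv x)
        ; size≤  = ≤-trans (≤-reflexive (sym (+-suc (length E) (length S)))) (size≤ inv)
        ; sparse = far ∷ sparse inv
        }
        where
        shuffle : ∀ a b c → a + b + c ≡ b + (a + c)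
        shuffle = solve-∀
        in≤′ : ∀ x → incount ((u , v) ∷ E) x ≤ 2 * d
        in≤′ x with x F.≟ v
        ... | yes refl = unsat
        ... | no _     = in≤ inv x

      next : ∃ λ v → Ok v × Φ ((u , v) ∷ E) S * q ≤ Φ E (u ∷ S)
      next = let v , pos , Φ≤ = weighted-pick (allFin n) (λ v → ⟦ ok? v ⟧) (λ v → Φ ((u , v) ∷ E) S * q)
                                              (Φ E (u ∷ S)) average options>0
             in v , ⟦⟧-pos (ok? v) pos , Φ≤

    -- Each step lowers the potential by at least a factor q and the threshold by exactly q, so the
    -- strict inequality persists. At the end it says that a sum of indicators is below 1, hence 0.
    run : ∀ S E → Invariant E S → Φ E S < q ^ length S → ∃ λ E′ → Invariant E′ [] × (∀ c → ¬ Alive E′ c)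
    run [] E inv Φ<1 = E , inv , λ c alive → contradiction (begin-strict
      0                               <⟨ z<s ⟩
      1                               ≡⟨ sym (⟦⟧-true (alive? E c) alive) ⟩
      ⟦ alive? E c ⟧                  ≡⟨ sym (*-identityʳ _) ⟩
      ⟦ alive? E c ⟧ * 1              ≤⟨ ∑-∈ (λ c → ⟦ alive? E c ⟧ * 1) (∈-configs c) ⟩
      Φ E []                          ≤⟨ ℕ.s≤s⁻¹ Φ<1 ⟩
      0                               ∎) (<-irrefl refl)
      where open ≤-Reasoning
    run (u ∷ S) E inv Φ< = continue (Step.next inv)
      where
      continue : (∃ λ v → Step.Ok inv v × Φ ((u , v) ∷ E) S * q ≤ Φ E (u ∷ S)) →
                 ∃ λ E′ → Invariant E′ [] × (∀ c → ¬ Alive E′ c)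
      continue (v , ok , Φ≤) = run S ((u , v) ∷ E) (Step.extend inv v ok)
        (*-cancelʳ-< q (Φ ((u , v) ∷ E) S) (q ^ length S)
          (≤-<-trans Φ≤ (<-≤-trans Φ< (≤-reflexive (*-comm q (q ^ length S))))))

  -- Layerings of acyclic sets

  does⇒ : {P : Set} (p : Dec P) → does p ≡ true → P
  does⇒ (yes p) _ = p

  module _ (D : Digraph) where

    private
      V = Fin (n D)

    module _ {P : V → Set} (s : ℕ → V) (P-s : ∀ k → P (s k)) (step : ∀ k → Arc D (s k) (s (suc k))) where

      -- A closed stretch of the walk that is not a cycle contains a shorter closed stretch.
      closed-walk⇒cycle : ∀ l i → s i ≡ s (i + suc l) → ∃ (DirCycleIn D P)
      closed-walk⇒cycle = <-rec (λ l → ∀ i → s i ≡ s (i + suc l) → ∃ (DirCycleIn D P)) shorten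
        where
        shorten : ∀ l → (∀ {t} → t < l → ∀ i → s i ≡ s (i + suc t) → ∃ (DirCycleIn D P)) →
                  ∀ i → s i ≡ s (i + suc l) → ∃ (DirCycleIn D P)
        shorten l rec i closed
          with FP.any? (λ (a : Fin (suc l)) → FP.any? (λ (b : Fin (suc l)) →
                 (toℕ a <? toℕ b) ×-dec (s (i + toℕ a) F.≟ s (i + toℕ b))))
        ... | yes (a , b , a<b , eq) = rec {t} t<l (i + toℕ a) (trans eq (cong s (sym i+a+t)))
          where
          t = toℕ b ∸ suc (toℕ a)
          a+t : suc (toℕ a) + t ≡ toℕ b
          a+t = m+[n∸m]≡n a<b
          t<l : t < l
          t<l = ≤-trans (≤-trans (s≤s (m≤n+m t (toℕ a))) (≤-reflexive a+t)) (ℕ.s≤s⁻¹ (FP.toℕ<n b))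
          i+a+t : i + toℕ a + suc t ≡ i + toℕ b
          i+a+t = trans (+-assoc i (toℕ a) (suc t)) (cong (i +_) (trans (+-suc (toℕ a) t) a+t))
        -- A closed stretch of length one is a loop, whereas `DirCycleIn` begins with two vertices.
        shorten zero rec i closed | no _ =
          contradiction (trans (sym (loopless D (s i)))
            (subst (Arc D (s i)) (sym (trans closed (cong s (+-comm i 1)))) (step i))) λ ()
        shorten (suc m) rec i closed | no distinct = m , f , inj , (λ a → P-s (i + toℕ a)) , arcs , closing
          where
          f : Fin (2 + m) → V
          f a = s (i + toℕ a)
          inj : Injective _≡_ _≡_ f
          inj {a} {b} eq with <-cmp (toℕ a) (toℕ b)
          ... | tri< a<b _ _ = contradiction (a , b , a<b , eq) distinct
          ... | tri≈ _ a≡b _ = FP.toℕ-injective a≡b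
          ... | tri> _ _ b<a = contradiction (b , a , b<a , sym eq) distinct
          arcs : ∀ (a : Fin (suc m)) → Arc D (f (inject₁ a)) (f (suc a))
          arcs a = subst₂ (λ x y → Arc D (s x) (s y)) (cong (i +_) (sym (FP.toℕ-inject₁ a))) (sym (+-suc i (toℕ a)))
                          (step (i + toℕ a))
          closing : Arc D (f (fromℕ (suc m))) (f zero)
          closing = subst₂ (λ x y → Arc D (s x) y) (cong (i +_) (sym (FP.toℕ-fromℕ (suc m))))
            (trans (trans (cong s (sym (+-suc i (suc m)))) (sym closed)) (cong s (sym (+-identityʳ i))))
            (step (i + suc m))

      infinite-walk⇒cycle : ∃ (DirCycleIn D P)
      infinite-walk⇒cycle with FP.pigeonhole (n<1+n (n D)) (s ∘ toℕ)
      ... | a , b , a<b , eq = closed-walk⇒cycle (toℕ b ∸ suc (toℕ a)) (toℕ a)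
            (trans eq (cong s (sym (trans (+-suc (toℕ a) _) (m+[n∸m]≡n a<b)))))

    _∈ᵇ_ : V → (V → Bool) → Set
    v ∈ᵇ T = T v ≡ true

    -- If no member were a sink, following successors inside `T` would give an infinite walk, which
    -- in a finite digraph contains a cycle.
    sink : (T : V → Bool) → Acyclic D (_∈ᵇ T) → ∀ u → u ∈ᵇ T → ∃ λ u → u ∈ᵇ T × (∀ v → v ∈ᵇ T → ¬ Arc D u v)
    sink T acyclic u₀ u₀∈T
      with FP.any? (λ u → (T u Bool.≟ true) ×-dec FP.all? (λ v → (T v Bool.≟ true) →-dec ¬? (arc D u v Bool.≟ true)))
    ... | yes found = found
    ... | no nosink = ⊥-elim (let m , cycle = infinite-walk⇒cycle {_∈ᵇ T} (proj₁ ∘ walk) (proj₂ ∘ walk) walk-step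
                              in acyclic m cycle)
      where
      successor : ∀ u → u ∈ᵇ T → ∃ λ v → v ∈ᵇ T × Arc D u v
      successor u u∈T with FP.any? (λ v → (T v Bool.≟ true) ×-dec (arc D u v Bool.≟ true))
      ... | yes found = found
      ... | no none   = contradiction (u , u∈T , λ v v∈T a → none (v , v∈T , a)) nosink
      walk : ℕ → ∃ (_∈ᵇ T)
      walk zero    = u₀ , u₀∈T
      walk (suc k) = let u , u∈T = walk k ; v , v∈T , _ = successor u u∈T in v , v∈T
      walk-step : ∀ k → Arc D (proj₁ (walk k)) (proj₁ (walk (suc k)))
      walk-step k = let u , u∈T = walk k ; _ , _ , a = successor u u∈T in a

    ∣_∣ᵇ : (V → Bool) → ℕ
    ∣ T ∣ᵇ = ∑ (allFin (n D)) (indicator ∘ T)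

    count-update : ∀ {r} (c : Vec (Fin (suc r)) (n D)) u i j → lookup c u ≡ zero →
                   count (suc j) (c [ u ]≔ suc i) ≡ ⟦ i F.≟ j ⟧ + count (suc j) c
    count-update c u i j cu≡0 = begin
      ∑ (allFin (n D)) (λ x → ⟦ lookup (c [ u ]≔ suc i) x F.≟ suc j ⟧)
        ≡⟨ ∑-cong (allFin (n D)) pointwise ⟩
      ∑ (allFin (n D)) (λ x → ⟦ i F.≟ j ⟧ * ⟦ x F.≟ u ⟧ + ⟦ lookup c x F.≟ suc j ⟧)
        ≡⟨ ∑-+ (allFin (n D)) _ _ ⟩
      ∑ (allFin (n D)) (λ x → ⟦ i F.≟ j ⟧ * ⟦ x F.≟ u ⟧) + count (suc j) c
        ≡⟨ cong (_+ count (suc j) c) (trans (∑-*ˡ (allFin (n D)) ⟦ i F.≟ j ⟧ _)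
             (trans (cong (⟦ i F.≟ j ⟧ *_) (∑-δ′ (n D) u)) (*-identityʳ _))) ⟩
      ⟦ i F.≟ j ⟧ + count (suc j) c ∎
      where
      open ≡-Reasoning
      pointwise : ∀ x → ⟦ lookup (c [ u ]≔ suc i) x F.≟ suc j ⟧ ≡ ⟦ i F.≟ j ⟧ * ⟦ x F.≟ u ⟧ + ⟦ lookup c x F.≟ suc j ⟧
      pointwise x with x F.≟ u
      ... | yes refl rewrite lookup∘update u c (suc i) | cu≡0 = sym (trans (+-identityʳ _) (*-identityʳ _))
      ... | no x≢u rewrite lookup∘update′ x≢u c (suc i) | *-zeroʳ ⟦ i F.≟ j ⟧ = refl

    -- `inside` and `labels` carry the induction of `layering`: the first shows that the sink just
    -- removed is unlabelled by the rest, the second compares its label with all others.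
    record Layering {r} (ls : List (Fin r)) (T : V → Bool) : Set where
      field
        layer   : Vec (Fin (suc r)) (n D)
        sizes   : ∀ j → count (suc j) layer ≡ ∑ ls (λ i → ⟦ i F.≟ j ⟧)
        inside  : ∀ u → lookup layer u ≡ zero ⊎ u ∈ᵇ T
        labels  : ∀ u i → lookup layer u ≡ suc i → i ∈ ls
        forward : ∀ u v → Arc D u v → ¬ (0 < toℕ (lookup layer u) × toℕ (lookup layer u) < toℕ (lookup layer v))

    -- Sinks are removed one at a time and receive the labels in increasing order.
    layering : ∀ {r} (ls : List (Fin r)) → AllPairs F._≤_ ls → (T : V → Bool) → Acyclic D (_∈ᵇ T) →
               length ls ≤ ∣ T ∣ᵇ → Layering ls T
    layering [] _ T _ _ = record
      { layer   = none
      ; sizes   = λ j → ∑-zero (allFin (n D)) λ u → ⟦⟧-false (lookup none u F.≟ suc j)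
                    λ eq → contradiction (trans (sym (lookup-replicate u zero)) eq) λ ()
      ; inside  = λ u → inj₁ (lookup-replicate u zero)
      ; labels  = λ u i eq → contradiction (trans (sym (lookup-replicate u zero)) eq) λ ()
      ; forward = λ u v _ (0<u , _) → contradiction (subst (λ a → 0 < toℕ a) (lookup-replicate u zero) 0<u) λ ()
      }
      where
      none = Vec.replicate (n D) zero
    layering {r} (i ∷ ls) (i≤ ∷ sorted) T acyclic size
      -- All values are 0 here; only a member of the non-empty set is extracted.
      with weighted-pick (allFin (n D)) (indicator ∘ T) (λ _ → 0) 0
             (≤-reflexive (trans (∑-zero (allFin (n D)) (λ x → *-zeroʳ (indicator (T x)))) (sym (*-zeroʳ ∣ T ∣ᵇ))))
             (≤-trans z<s size)
    ... | u₀ , 0<T , _ with sink T acyclic u₀ (indicator-pos (T u₀) 0<T)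
      where
      indicator-pos : ∀ b → 0 < indicator b → b ≡ true
      indicator-pos true _ = refl
    ...   | u , u∈T , u-sink = record
      { layer   = c′
      ; sizes   = λ j → trans (count-update c u i j cu≡0) (cong (⟦ i F.≟ j ⟧ +_) (sizes j))
      ; inside  = inside′
      ; labels  = labels′
      ; forward = forward′
      }
      where
      T′ : V → Bool
      T′ x = T x ∧ not (does (x F.≟ u))
      T′⊆T : ∀ {x} → x ∈ᵇ T′ → x ∈ᵇ T
      T′⊆T {x} = ∧-conicalˡ (T x) _
      u∉T′ : ¬ u ∈ᵇ T′
      u∉T′ u∈ rewrite dec-true (u F.≟ u) refl | u∈T = contradiction u∈ λ ()
      pointwise : ∀ x → indicator (T x) ≤ ⟦ x F.≟ u ⟧ + indicator (T′ x)
      pointwise x with x F.≟ u | T x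
      ... | yes _ | true  = s≤s z≤n
      ... | yes _ | false = z≤n
      ... | no _  | true  = s≤s z≤n
      ... | no _  | false = z≤n
      size′ : length ls ≤ ∣ T′ ∣ᵇ
      size′ = ℕ.s≤s⁻¹ (≤-trans size (≤-trans (∑-mono (allFin (n D)) pointwise)
        (≤-reflexive (trans (∑-+ (allFin (n D)) _ _) (cong (_+ ∣ T′ ∣ᵇ) (∑-δ′ (n D) u))))))
      rest : Layering ls T′
      rest = layering ls sorted T′ (λ m (f , inj , in-T′ , cycle) → acyclic m (f , inj , T′⊆T ∘ in-T′ , cycle)) size′
      open Layering rest renaming (layer to c)
      cu≡0 : lookup c u ≡ zero
      cu≡0 with inside u
      ... | inj₁ eq = eq
      ... | inj₂ u∈ = contradiction u∈ u∉T′
      c′ = c [ u ]≔ suc i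
      inside′ : ∀ x → lookup c′ x ≡ zero ⊎ x ∈ᵇ T
      inside′ x with x F.≟ u
      ... | yes refl = inj₂ u∈T
      ... | no x≢u rewrite lookup∘update′ x≢u c (suc i) = Sum.map₂ T′⊆T (inside x)
      labels′ : ∀ x j → lookup c′ x ≡ suc j → j ∈ i ∷ ls
      labels′ x j eq with x F.≟ u
      ... | yes refl = here (FP.suc-injective (trans (sym eq) (lookup∘update u c (suc i))))
      ... | no x≢u   = there (labels x j (trans (sym (lookup∘update′ x≢u c (suc i))) eq))
      forward′ : ∀ x y → Arc D x y → ¬ (0 < toℕ (lookup c′ x) × toℕ (lookup c′ x) < toℕ (lookup c′ y))
      forward′ x y a (0<x , x<y) with x F.≟ u | y F.≟ u
      ... | yes refl | yes refl = <-irrefl refl x<y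
      ... | yes refl | no y≢u with inside y
      ...   | inj₂ y∈T′ = u-sink y (T′⊆T y∈T′) a
      ...   | inj₁ cy≡0 rewrite lookup∘update′ y≢u c (suc i) | cy≡0 = contradiction x<y λ ()
      forward′ x y a (0<x , x<y) | no x≢u | no y≢u
        rewrite lookup∘update′ x≢u c (suc i) | lookup∘update′ y≢u c (suc i) = forward x y a (0<x , x<y)
      forward′ x y a (0<x , x<y) | no x≢u | yes refl
        rewrite lookup∘update′ x≢u c (suc i) | lookup∘update u c (suc i) with lookup c x in eq
      -- `x` received its label from the rest of the sorted list, so that label is at least `i`.
      ... | suc j = <⇒≱ (ℕ.s≤s⁻¹ x<y) (All.lookup i≤ (labels x j eq))

  blocks : ∀ r → ℕ → List (Fin r)
  blocks zero    m = []
  blocks (suc r) m = replicate m zero ++ map suc (blocks r m)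

  length-blocks : ∀ r m → length (blocks r m) ≡ r * m
  length-blocks zero    m = refl
  length-blocks (suc r) m = trans (length-++ (replicate m zero))
    (cong₂ _+_ (length-replicate m) (trans (length-map suc (blocks r m)) (length-blocks r m)))

  blocks-sorted : ∀ r m → AllPairs F._≤_ (blocks r m)
  blocks-sorted zero    m = []
  blocks-sorted (suc r) m = AllPairs.++⁺ (zeros m)
    (AllPairs.map⁺ (AllPairs.map s≤s (blocks-sorted r m)))
    (All.replicate⁺ m (All.universal (λ _ → z≤n) _))
    where
    zeros : ∀ m → AllPairs F._≤_ (replicate m (zero {r}))
    zeros zero    = []
    zeros (suc m) = All.replicate⁺ m z≤n ∷ zeros m

  blocks-count : ∀ r m j → ∑ (blocks r m) (λ i → ⟦ i F.≟ j ⟧) ≡ m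
  blocks-count (suc r) m j = trans (∑-++ (replicate m zero) _ _)
    (trans (cong₂ _+_ (zeros m) (later (blocks r m))) (total j))
    where
    zeros : ∀ m → ∑ (replicate m zero) (λ i → ⟦ i F.≟ j ⟧) ≡ m * ⟦ zero F.≟ j ⟧
    zeros zero    = refl
    zeros (suc m) = cong (⟦ zero F.≟ j ⟧ +_) (zeros m)
    later : ∀ is → ∑ (map suc is) (λ i → ⟦ i F.≟ j ⟧) ≡ ∑ is (λ i → ⟦ suc i F.≟ j ⟧)
    later []       = refl
    later (i ∷ is) = cong (⟦ suc i F.≟ j ⟧ +_) (later is)
    total : ∀ j → m * ⟦ zero F.≟ j ⟧ + ∑ (blocks r m) (λ i → ⟦ suc i F.≟ j ⟧) ≡ m
    total zero    = trans (cong₂ _+_ (*-identityʳ m) (∑-zero (blocks r m) (λ _ → refl))) (+-identityʳ m)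
    total (suc j) = trans (cong (_+ ∑ (blocks r m) (λ i → ⟦ i F.≟ j ⟧)) (*-zeroʳ m)) (blocks-count r m j)

  -- The resulting digraph

  cycled : {A : Set} → ℕ → List A → List A
  cycled k xs = concat (replicate k xs)

  ∑-cycled : ∀ {A : Set} k (xs : List A) f → ∑ (cycled k xs) f ≡ k * ∑ xs f
  ∑-cycled zero    xs f = refl
  ∑-cycled (suc k) xs f = trans (∑-++ xs _ f) (cong (∑ xs f +_) (∑-cycled k xs f))

  ∏-cycled : ∀ {A : Set} k (xs : List A) f → ∏ (cycled k xs) f ≡ ∏ xs f ^ k
  ∏-cycled zero    xs f = refl
  ∏-cycled (suc k) xs f = trans (∏-++ xs _ f) (cong (∏ xs f *_) (∏-cycled k xs f))

  length-cycled : ∀ {A : Set} k (xs : List A) → length (cycled k xs) ≡ k * length xs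
  length-cycled zero    xs = refl
  length-cycled (suc k) xs = trans (length-++ xs) (cong (length xs +_) (length-cycled k xs))

  digraph : ∀ {n} (E : Arcs {n}) → (∀ v → (v , v) ∉ E) → Digraph
  digraph {n} E noloop = record
    { n        = n
    ; arc      = λ u v → does ((u , v) ∈? E)
    ; loopless = λ v → dec-false ((v , v) ∈? E) (noloop v)
    }

  -- The radius is `suc R`, so it is positive for every `R`, as the exclusion of digons demands.
  module Construction (n d r m q R : ℕ) (n≡qm : n ≡ q * m) (2m<n : 2 * m < n) (0<d : 0 < d)
                      (ball≤m : suc (3 * d) ^ suc R ≤ m) where

    open Greedy n d r m q (suc R) n≡qm 2m<n 0<d ball≤m
    open Invariant

    module Final {E : Arcs} (inv : Invariant E []) where

      D : Digraph
      D = digraph E (Sparse-loopless (sparse inv))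

      arc⇒∈ : ∀ {u v} → Arc D u v → (u , v) ∈ E
      arc⇒∈ {u} {v} = does⇒ ((u , v) ∈? E)

      ∈⇒arc : ∀ {u v} → (u , v) ∈ E → Arc D u v
      ∈⇒arc {u} {v} = dec-true ((u , v) ∈? E)

      girth : GirthAtLeast D R
      girth = (λ _ (u , v , _ , a , b) → Sparse-nodigon (sparse inv) (arc⇒∈ a) (arc⇒∈ b))
            , λ k k<R (f , inj , adj , closing) → Sparse-nocycle (sparse inv) k
                (≤-trans (n≤1+n _) (≤-trans (<⇒≤ k<R) (n≤1+n R)))
                f inj (Sum.map arc⇒∈ arc⇒∈ ∘ adj) (Sum.map arc⇒∈ arc⇒∈ closing)

      degree : MaxDegreeAtMost D (3 * d)
      degree v = +-mono-≤ (≤-trans (∑-∈-out E v) (≤-trans (m≤m+n _ _) (out≤ inv v)))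
                          (≤-trans (∑-∈-in E v) (in≤ inv v))

      class? : ∀ {k} (col : Fin n → Fin k) j v → Dec (Unsaturated E v × col v ≡ j)
      class? col j v = (incount E v <? 2 * d) ×-dec (col v F.≟ j)

      class-size : ∀ {k} → (Fin n → Fin k) → Fin k → ℕ
      class-size col j = ∑ (allFin n) (λ v → ⟦ class? col j v ⟧)

      ∑-class-size : ∀ {k} (col : Fin n → Fin k) → unsaturated E ≤ ∑ (allFin k) (class-size col)
      ∑-class-size {k} col = ≤-trans (∑-mono (allFin n) pointwise) (≤-reflexive (∑-swap (allFin n) (allFin k) _))
        where
        pointwise : ∀ v → ⟦ incount E v <? 2 * d ⟧ ≤ ∑ (allFin k) (λ j → ⟦ class? col j v ⟧)
        pointwise v = ⟦⟧-≤ (incount E v <? 2 * d) λ unsat →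
          ≤-trans (≤-reflexive (sym (⟦⟧-true (class? col (col v) v) (unsat , refl))))
                  (∑-∈ (λ j → ⟦ class? col j v ⟧) (∈-allFin (col v)))

      -- At least n/2 vertices are unsaturated, hence the factor 2. If every colour held fewer than
      -- `s` of them, they would number at most k·s - k.
      large-class : ∀ {k} (col : Fin n → Fin k) s → k * s * 2 ≤ n → ∃ λ j → s ≤ class-size col j
      large-class {k} col s le with FP.any? (λ j → s ≤? class-size col j)
      ... | yes found = found
      ... | no none   = contradiction (begin-strict
        U                                                 <⟨ m<m+n U 0<k ⟩
        U + k                                             ≤⟨ +-monoˡ-≤ k (∑-class-size col) ⟩
        ∑ (allFin k) (class-size col) + k                 ≡⟨ cong (∑ (allFin k) (class-size col) +_) (sym ones) ⟩
        ∑ (allFin k) (class-size col) + ∑ (allFin k) (λ _ → 1)  ≡⟨ sym (∑-+ (allFin k) (class-size col) (λ _ → 1)) ⟩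
        ∑ (allFin k) (λ j → class-size col j + 1)
          ≤⟨ ∑-mono (allFin k) (λ j → ≤-trans (≤-reflexive (+-comm _ 1)) (≰⇒> (none ∘ (j ,_)))) ⟩
        ∑ (allFin k) (λ _ → s)                            ≡⟨ ∑-allFin-const k s ⟩
        k * s
          ≤⟨ *-cancelʳ-≤ (k * s) U 2 (≤-trans le (≤-trans (unsaturated-≥ inv) (≤-reflexive (*-comm 2 U)))) ⟩
        U                                                 ∎) (<-irrefl refl)
        where
        open ≤-Reasoning
        U = unsaturated E
        ones : ∑ (allFin k) (λ _ → 1) ≡ k
        ones = trans (∑-allFin-const k 1) (*-identityʳ k)
        -- The contradiction has margin k. A vertex exists because n > 2m, and its colour shows that
        -- k is positive.
        0<k : 0 < k
        0<k = ≤-trans z<s (FP.toℕ<n (col (F.fromℕ< (≤-<-trans z≤n 2m<n))))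

      -- The unsaturated part of a large colour class is layered into r blocks of size m, which
      -- would be a live block system.
      not-colourable : (∀ c → ¬ Alive E c) → ∀ k → k * (r * m) * 2 ≤ n → ¬ AcyclicColouring D k
      not-colourable dead k le (col , acyclic) = dead layer (sizes′ , inside′ , All.tabulate λ {(u , v)} e → forward u v (∈⇒arc e))
        where
        j = proj₁ (large-class col (r * m) le)
        T : Fin n → Bool
        T v = does (class? col j v)
        T-class : ∀ {v} → T v ≡ true → Unsaturated E v × col v ≡ j
        T-class {v} = does⇒ (class? col j v)
        layers : Layering D (blocks r m) T
        layers = layering D (blocks r m) (blocks-sorted r m) T
          (λ k (f , inj , f∈T , cycle) → acyclic j k (f , inj , proj₂ ∘ T-class ∘ f∈T , cycle))
          (≤-trans (≤-reflexive (length-blocks r m)) (proj₂ (large-class col (r * m) le)))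
        open Layering layers
        sizes′ : ∀ i → count (suc i) layer ≡ m
        sizes′ i = trans (sizes i) (blocks-count r m i)
        inside′ : ∀ u → lookup layer u ≡ zero ⊎ Unsaturated E u
        inside′ u = Sum.map₂ (proj₁ ∘ T-class) (inside u)

    blockWeight : ℕ
    blockWeight = ∏ (allFin r) (weight ∘ suc)

    -- `H` is the wanted bound on the initial potential after taking m-th roots. It involves neither
    -- m nor n, so the girth does not influence the numerical part.
    module Start (r≤q : r ≤ q) (H : blockWeight ^ d * ((q + r) ^ q * q ^ r) < q ^ (d * r) * q ^ q) where

      outside : ℕ
      outside = n ∸ r * m

      outside+blocks : outside + r * m ≡ n
      outside+blocks = m∸n+n≡m (≤-trans (*-monoˡ-≤ m r≤q) (≤-reflexive (sym n≡qm)))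

      count-zero : ∀ {c : Config} → (∀ i → count (suc i) c ≡ m) → count zero c ≡ outside
      count-zero {c} sizes = sym (trans (cong (_∸ r * m) (sym total)) (m+n∸n≡m (count zero c) (r * m)))
        where
        total : count zero c + r * m ≡ n
        total = trans (cong (count zero c +_) (sym (trans (∑-cong (allFin r) sizes) (∑-allFin-const r m))))
                 (trans (sym (∑-allFin-suc r (λ a → count a c))) (∑-count c))

      ∏-sizes : ∀ {c : Config} → (∀ i → count (suc i) c ≡ m) → (w : Fin (suc r) → ℕ) →
                ∏ (allFin n) (w ∘ lookup c) ≡ w zero ^ outside * ∏ (allFin r) (w ∘ suc) ^ m
      ∏-sizes {c} sizes w = begin
        ∏ (allFin n) (w ∘ lookup c)
          ≡⟨ ∏-multiplicity (allFin n) (lookup c) w ⟩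
        ∏ (allFin (suc r)) (λ a → w a ^ count a c)
          ≡⟨ ∏-allFin-suc r (λ a → w a ^ count a c) ⟩
        w zero ^ count zero c * ∏ (allFin r) (λ i → w (suc i) ^ count (suc i) c)
          ≡⟨ cong₂ _*_ (cong (w zero ^_) (count-zero {c} sizes))
               (trans (∏-cong (allFin r) (λ i → cong (w (suc i) ^_) (sizes i))) (∏-^ (allFin r) (w ∘ suc) m)) ⟩
        w zero ^ outside * ∏ (allFin r) (w ∘ suc) ^ m ∎
        where open ≡-Reasoning

      schedule : List (Fin n)
      schedule = cycled d (allFin n)

      length-schedule : length schedule ≡ d * n
      length-schedule = trans (length-cycled d (allFin n)) (cong (d *_) (length-tabulate id))

      invariant₀ : Invariant [] schedule
      invariant₀ = record
        { in≤    = λ _ → z≤n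
        ; out≤   = λ u → ≤-reflexive (trans (∑-cycled d (allFin n) _) (trans (cong (d *_) (∑-δ n u)) (*-identityʳ d)))
        ; size≤  = ≤-reflexive (trans length-schedule (*-comm d n))
        ; sparse = []
        }

      total : ℕ
      total = (q ^ outside * blockWeight ^ m) ^ d

      -- A generating-function bound in place of a multinomial coefficient: each live word has
      -- marker product `q ^ outside`, so there are at most (q+r)^n / q^outside of them. The weights
      -- q and 1 roughly match the class proportions.
      marker : Fin (suc r) → ℕ
      marker zero    = q
      marker (suc _) = 1

      Φ₀-bound : Φ [] schedule * q ^ outside ≤ total * (q + r) ^ n
      Φ₀-bound = begin
        Φ [] schedule * q ^ outside
          ≡⟨ sym (∑-*ʳ Cs _ (q ^ outside)) ⟩
        ∑ Cs (λ c → ⟦ alive? [] c ⟧ * ∏ schedule (weight ∘ lookup c) * q ^ outside)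
          ≤⟨ ∑-mono Cs pointwise ⟩
        ∑ Cs (λ c → total * ∏ (allFin n) (marker ∘ lookup c))
          ≡⟨ ∑-*ˡ Cs total _ ⟩
        total * ∑ Cs (λ c → ∏ (allFin n) (marker ∘ lookup c))
          ≡⟨ cong (total *_) (trans (∑-configs-∏ (suc r) n marker) (cong (_^ n) markers)) ⟩
        total * (q + r) ^ n ∎
        where
        open ≤-Reasoning
        Cs = configs (suc r) n
        markers : ∑ (allFin (suc r)) marker ≡ q + r
        markers = trans (∑-allFin-suc r marker)
          (cong (q +_) (trans (∑-allFin-const r 1) (*-identityʳ r)))
        pointwise : ∀ c → ⟦ alive? [] c ⟧ * ∏ schedule (weight ∘ lookup c) * q ^ outside
                          ≤ total * ∏ (allFin n) (marker ∘ lookup c)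
        pointwise c = ⟦⟧-elim (alive? [] c)
          (λ b → b * ∏ schedule (weight ∘ lookup c) * q ^ outside ≤ total * ∏ (allFin n) (marker ∘ lookup c))
          (λ (sizes , _) → ≤-reflexive (cong₂ _*_
            (trans (*-identityˡ _) (trans (∏-cycled d (allFin n) _) (cong (_^ d) (∏-sizes {c} sizes weight))))
            (sym (trans (∏-sizes {c} sizes marker)
              (trans (cong (q ^ outside *_) (trans (cong (_^ m) (∏-one (allFin r))) (^-zeroˡ m))) (*-identityʳ _))))))
          (λ _ → z≤n)

      0<m : 0 < m
      0<m = ≤-trans (m^n>0 (suc (3 * d)) (suc R)) ball≤m

      0<q : 0 < q
      0<q = n≢0⇒n>0 λ q≡0 → contradiction (subst (2 * m <_) (trans n≡qm (cong (_* m) q≡0)) 2m<n) λ ()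

      Φ₀-small : Φ [] schedule < q ^ length schedule
      -- `q ^ outside` clears the denominator of the count, and `q ^ (r * m)` completes it to q^n.
      -- Apart from the common factor `(q ^ outside) ^ d`, both sides are then m-th powers.
      Φ₀-small = *-cancelʳ-< (q ^ outside * q ^ (r * m)) _ _ (begin-strict
        Φ [] schedule * (q ^ outside * q ^ (r * m))
          ≡⟨ sym (*-assoc (Φ [] schedule) _ _) ⟩
        Φ [] schedule * q ^ outside * q ^ (r * m)
          ≤⟨ *-monoˡ-≤ (q ^ (r * m)) Φ₀-bound ⟩
        (q ^ outside * blockWeight ^ m) ^ d * (q + r) ^ n * q ^ (r * m)
          ≡⟨ cong₂ _*_ (cong₂ _*_ (^-distribʳ-* d (q ^ outside) (blockWeight ^ m))
               (trans (cong ((q + r) ^_) n≡qm) (sym (^-*-assoc (q + r) q m)))) (sym (^-*-assoc q r m)) ⟩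
        (q ^ outside) ^ d * (blockWeight ^ m) ^ d * ((q + r) ^ q) ^ m * (q ^ r) ^ m
          ≡⟨ cong (λ x → (q ^ outside) ^ d * x * ((q + r) ^ q) ^ m * (q ^ r) ^ m) (^-exchange blockWeight m d) ⟩
        (q ^ outside) ^ d * (blockWeight ^ d) ^ m * ((q + r) ^ q) ^ m * (q ^ r) ^ m
          ≡⟨ regroup ((q ^ outside) ^ d) ((blockWeight ^ d) ^ m) (((q + r) ^ q) ^ m) ((q ^ r) ^ m) ⟩
        (q ^ outside) ^ d * ((blockWeight ^ d) ^ m * (((q + r) ^ q) ^ m * (q ^ r) ^ m))
          ≡⟨ cong ((q ^ outside) ^ d *_) (trans (cong ((blockWeight ^ d) ^ m *_) (sym (^-distribʳ-* m ((q + r) ^ q) (q ^ r))))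
               (sym (^-distribʳ-* m (blockWeight ^ d) _))) ⟩
        (q ^ outside) ^ d * (blockWeight ^ d * ((q + r) ^ q * q ^ r)) ^ m
          <⟨ *-monoʳ-< ((q ^ outside) ^ d) {{ℕ.>-nonZero (m^n>0 (q ^ outside) {{ℕ.>-nonZero (m^n>0 q {{ℕ.>-nonZero 0<q}} outside)}} d)}}
               (^-monoˡ-< m {{ℕ.>-nonZero 0<m}} H) ⟩
        (q ^ outside) ^ d * (q ^ (d * r) * q ^ q) ^ m
          ≡⟨ cong₂ _*_ (^-*-assoc q outside d) (trans (cong (_^ m) (sym (^-distribˡ-+-* q (d * r) q))) (^-*-assoc q (d * r + q) m)) ⟩
        q ^ (outside * d) * q ^ ((d * r + q) * m)
          ≡⟨ sym (^-distribˡ-+-* q (outside * d) ((d * r + q) * m)) ⟩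
        q ^ (outside * d + (d * r + q) * m)
          ≡⟨ cong (q ^_) exponents ⟩
        q ^ (length schedule + (outside + r * m))
          ≡⟨ trans (^-distribˡ-+-* q (length schedule) _) (cong (q ^ length schedule *_) (^-distribˡ-+-* q outside (r * m))) ⟩
        q ^ length schedule * (q ^ outside * q ^ (r * m)) ∎)
        where
        open ≤-Reasoning
        ^-exchange : ∀ x a b → (x ^ a) ^ b ≡ (x ^ b) ^ a
        ^-exchange x a b = trans (^-*-assoc x a b) (trans (cong (x ^_) (*-comm a b)) (sym (^-*-assoc x b a)))
        regroup : ∀ a b c e → a * b * c * e ≡ a * (b * (c * e))
        regroup = solve-∀
        expand : ∀ o d r q m → o * d + (d * r + q) * m ≡ d * (o + r * m) + q * m
        expand = solve-∀
        exponents : outside * d + (d * r + q) * m ≡ length schedule + (outside + r * m)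
        exponents = trans (expand outside d r q m)
          (cong₂ _+_ (trans (cong (d *_) outside+blocks) (sym length-schedule)) (trans (sym n≡qm) (sym outside+blocks)))

      conclusion : Σ Digraph λ D → GirthAtLeast D R × MaxDegreeAtMost D (3 * d) ×
                   (∀ k → k * (r * m) * 2 ≤ n → ¬ AcyclicColouring D k)
      conclusion = let E , inv , dead = run schedule [] invariant₀ Φ₀-small
                   in Final.D inv , Final.girth inv , Final.degree inv , Final.not-colourable inv dead

  -- Numerical estimates

  ^-pos : ∀ {x} → 0 < x → ∀ k → NonZero (x ^ k)
  ^-pos {x} 0<x k = m^n≢0 x k {{ℕ.>-nonZero 0<x}}

  -- (1 − j/q)(1 + 1/q)^j ≤ 1
  [q∸j][q+1]^j≤q^[1+j] : ∀ q j → (q ∸ j) * suc q ^ j ≤ q ^ suc j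
  [q∸j][q+1]^j≤q^[1+j] q zero    = ≤-refl
  [q∸j][q+1]^j≤q^[1+j] q (suc j) = begin
    (q ∸ suc j) * (suc q * suc q ^ j)   ≡⟨ sym (*-assoc (q ∸ suc j) (suc q) _) ⟩
    (q ∸ suc j) * suc q * suc q ^ j     ≤⟨ *-monoˡ-≤ (suc q ^ j) step ⟩
    q * (q ∸ j) * suc q ^ j             ≡⟨ *-assoc q (q ∸ j) _ ⟩
    q * ((q ∸ j) * suc q ^ j)           ≤⟨ *-monoʳ-≤ q ([q∸j][q+1]^j≤q^[1+j] q j) ⟩
    q * q ^ suc j                       ∎
    where
    open ≤-Reasoning
    pred-step : ∀ t → t ≤ q → ℕ.pred t * suc q ≤ q * t
    pred-step zero    _   = z≤n
    pred-step (suc t) t<q = ≤-trans (≤-reflexive (trans (*-suc t q) (cong (t +_) (*-comm t q))))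
      (≤-trans (+-monoˡ-≤ (q * t) (<⇒≤ t<q)) (≤-reflexive (sym (*-suc q t))))
    step : (q ∸ suc j) * suc q ≤ q * (q ∸ j)
    step = subst (λ x → x * suc q ≤ q * (q ∸ j)) (pred[m∸n]≡m∸[1+n] q j) (pred-step (q ∸ j) (m∸n≤m q j))

  -- The previous inequality is multiplied over the list, so that only the total penalty matters
  -- from here on.
  ∏-∸-bound : ∀ {A : Set} q (xs : List A) (p : A → ℕ) →
    ∏ xs (λ x → q ∸ p x) * suc q ^ ∑ xs p ≤ q ^ (length xs + ∑ xs p)
  ∏-∸-bound q []       p = ≤-refl
  ∏-∸-bound q (x ∷ xs) p = begin
    (q ∸ p x) * ∏ xs (λ x → q ∸ p x) * suc q ^ (p x + ∑ xs p)
      ≡⟨ cong ((q ∸ p x) * ∏ xs (λ x → q ∸ p x) *_) (^-distribˡ-+-* (suc q) (p x) (∑ xs p)) ⟩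
    (q ∸ p x) * ∏ xs (λ x → q ∸ p x) * (suc q ^ p x * suc q ^ ∑ xs p)
      ≡⟨ *-interchange (q ∸ p x) _ _ _ ⟩
    (q ∸ p x) * suc q ^ p x * (∏ xs (λ x → q ∸ p x) * suc q ^ ∑ xs p)
      ≤⟨ *-mono-≤ ([q∸j][q+1]^j≤q^[1+j] q (p x)) (∏-∸-bound q xs p) ⟩
    q ^ suc (p x) * q ^ (length xs + ∑ xs p)
      ≡⟨ sym (^-distribˡ-+-* q (suc (p x)) _) ⟩
    q ^ (suc (p x) + (length xs + ∑ xs p))
      ≡⟨ cong (q ^_) (shuffle (p x) (length xs) (∑ xs p)) ⟩
    q ^ (suc (length xs) + (p x + ∑ xs p)) ∎
    where
    open ≤-Reasoning
    shuffle : ∀ a b c → suc a + (b + c) ≡ suc b + (a + c)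
    shuffle = solve-∀

  -- An elementary substitute for (1 + 1/κ)^κ < e. With κ = 2K and j = K the factor 1 - j/κ is 1/2,
  -- so (1 + 1/κ)^K ≤ 2; squaring gives 4.
  [κ+1]^κ≤4κ^κ : ∀ K → 0 < K → suc (2 * K) ^ (2 * K) ≤ 4 * (2 * K) ^ (2 * K)
  [κ+1]^κ≤4κ^κ K 0<K = begin
    suc κ ^ (2 * K)          ≡⟨ double (suc κ) ⟩
    suc κ ^ K * suc κ ^ K    ≤⟨ *-mono-≤ half half ⟩
    2 * κ ^ K * (2 * κ ^ K)  ≡⟨ four (κ ^ K) ⟩
    4 * (κ ^ K * κ ^ K)      ≡⟨ cong (4 *_) (sym (double κ)) ⟩
    4 * κ ^ κ                ∎
    where
    open ≤-Reasoning
    κ = 2 * K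
    four : ∀ x → 2 * x * (2 * x) ≡ 4 * (x * x)
    four = solve-∀
    double : ∀ x → x ^ (2 * K) ≡ x ^ K * x ^ K
    double x = trans (cong (λ e → x ^ (K + e)) (+-identityʳ K)) (^-distribˡ-+-* x K K)
    2K∸K : 2 * K ∸ K ≡ K
    2K∸K = trans (m+n∸m≡n K (K + 0)) (+-identityʳ K)
    swap : ∀ K x → 2 * K * x ≡ K * (2 * x)
    swap = solve-∀
    half : suc κ ^ K ≤ 2 * κ ^ K
    half = *-cancelˡ-≤ K {{ℕ.>-nonZero 0<K}} (begin
      K * suc κ ^ K        ≡⟨ cong (_* suc κ ^ K) (sym 2K∸K) ⟩
      (κ ∸ K) * suc κ ^ K  ≤⟨ [q∸j][q+1]^j≤q^[1+j] κ K ⟩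
      2 * K * κ ^ K        ≡⟨ swap K (κ ^ K) ⟩
      K * (2 * κ ^ K)      ∎)

  -- For q = 2Kr the ratio 1 + r/q is 1 + 1/κ with κ = 2K, and the previous bound is raised to the
  -- power r.
  [q+r]^q≤4^r*q^q : ∀ K r → 0 < K → (2 * K * r + r) ^ (2 * K * r) ≤ 4 ^ r * (2 * K * r) ^ (2 * K * r)
  [q+r]^q≤4^r*q^q K r 0<K = begin
    (κ * r + r) ^ (κ * r)               ≡⟨ cong (_^ (κ * r)) (+-comm (κ * r) r) ⟩
    (suc κ * r) ^ (κ * r)               ≡⟨ ^-distribʳ-* (κ * r) (suc κ) r ⟩
    suc κ ^ (κ * r) * r ^ (κ * r)       ≡⟨ cong (_* r ^ (κ * r)) (sym (^-*-assoc (suc κ) κ r)) ⟩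
    (suc κ ^ κ) ^ r * r ^ (κ * r)       ≤⟨ *-monoˡ-≤ (r ^ (κ * r)) (^-monoˡ-≤ r ([κ+1]^κ≤4κ^κ K 0<K)) ⟩
    (4 * κ ^ κ) ^ r * r ^ (κ * r)
      ≡⟨ cong (_* r ^ (κ * r)) (trans (^-distribʳ-* r 4 (κ ^ κ)) (cong (4 ^ r *_) (^-*-assoc κ κ r))) ⟩
    4 ^ r * κ ^ (κ * r) * r ^ (κ * r)   ≡⟨ *-assoc (4 ^ r) _ _ ⟩
    4 ^ r * (κ ^ (κ * r) * r ^ (κ * r)) ≡⟨ cong (4 ^ r *_) (sym (^-distribʳ-* (κ * r) κ r)) ⟩
    4 ^ r * (κ * r) ^ (κ * r)           ∎
    where
    open ≤-Reasoning
    κ = 2 * K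

  blockPenalty : ℕ → ℕ
  blockPenalty r = ∑ (allFin r) (penalty ∘ suc)

  -- Per unit of m, the choice of a system contributes the factor (4q)^r and its survival at most
  -- (q/(q+1))^(ρd); the hypothesis makes the product less than 1.
  few-configs : ∀ K r d → 0 < K → 0 < r → let q = 2 * K * r ; ρ = blockPenalty r in
    (4 * q) ^ r * q ^ (ρ * d) < suc q ^ (ρ * d) →
    ∏ (allFin r) (λ i → q ∸ penalty (suc i)) ^ d * ((q + r) ^ q * q ^ r) < q ^ (d * r) * q ^ q
  few-configs K r d 0<K 0<r growth = *-cancelʳ-< (suc q ^ (ρ * d)) _ _ (begin-strict
    W ^ d * ((q + r) ^ q * q ^ r) * suc q ^ (ρ * d)
      ≤⟨ *-monoˡ-≤ (suc q ^ (ρ * d)) (*-monoʳ-≤ (W ^ d) (*-monoˡ-≤ (q ^ r) ([q+r]^q≤4^r*q^q K r 0<K))) ⟩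
    W ^ d * (4 ^ r * q ^ q * q ^ r) * suc q ^ (ρ * d)
      ≡⟨ regroup (W ^ d) (4 ^ r) (q ^ q) (q ^ r) (suc q ^ (ρ * d)) ⟩
    W ^ d * suc q ^ (ρ * d) * q ^ q * (4 ^ r * q ^ r)
      ≤⟨ *-monoˡ-≤ (4 ^ r * q ^ r) (*-monoˡ-≤ (q ^ q) weights) ⟩
    q ^ (d * r) * q ^ (ρ * d) * q ^ q * (4 ^ r * q ^ r)
      ≡⟨ cong (q ^ (d * r) * q ^ (ρ * d) * q ^ q *_) (sym (^-distribʳ-* r 4 q)) ⟩
    q ^ (d * r) * q ^ (ρ * d) * q ^ q * (4 * q) ^ r
      ≡⟨ regroup′ (q ^ (d * r)) (q ^ (ρ * d)) (q ^ q) ((4 * q) ^ r) ⟩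
    q ^ (d * r) * q ^ q * ((4 * q) ^ r * q ^ (ρ * d))
      <⟨ *-monoʳ-< (q ^ (d * r) * q ^ q)
           {{m*n≢0 (q ^ (d * r)) (q ^ q) {{^-pos 0<q (d * r)}} {{^-pos 0<q q}}}} growth ⟩
    q ^ (d * r) * q ^ q * suc q ^ (ρ * d) ∎)
    where
    open ≤-Reasoning
    q = 2 * K * r
    ρ = blockPenalty r
    W = ∏ (allFin r) (λ i → q ∸ penalty (suc i))
    0<q : 0 < q
    0<q = *-mono-≤ (*-mono-≤ (s≤s (z≤n {1})) 0<K) 0<r
    regroup : ∀ b f x y s → b * (f * x * y) * s ≡ b * s * x * (f * y)
    regroup = solve-∀
    regroup′ : ∀ a b c e → a * b * c * e ≡ a * c * (e * b)
    regroup′ = solve-∀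
    weights : W ^ d * suc q ^ (ρ * d) ≤ q ^ (d * r) * q ^ (ρ * d)
    weights = begin
      W ^ d * suc q ^ (ρ * d)     ≡⟨ cong (W ^ d *_) (sym (^-*-assoc (suc q) ρ d)) ⟩
      W ^ d * (suc q ^ ρ) ^ d     ≡⟨ sym (^-distribʳ-* d W (suc q ^ ρ)) ⟩
      (W * suc q ^ ρ) ^ d         ≤⟨ ^-monoˡ-≤ d (∏-∸-bound q (allFin r) (penalty ∘ suc)) ⟩
      (q ^ (length (allFin r) + ρ)) ^ d ≡⟨ cong (λ l → (q ^ (l + ρ)) ^ d) (length-tabulate {n = r} id) ⟩
      (q ^ (r + ρ)) ^ d           ≡⟨ ^-*-assoc q (r + ρ) d ⟩
      q ^ ((r + ρ) * d)           ≡⟨ cong (q ^_) (trans (*-distribʳ-+ d r ρ) (cong (_+ ρ * d) (*-comm r d))) ⟩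
      q ^ (d * r + ρ * d)         ≡⟨ ^-distribˡ-+-* q (d * r) (ρ * d) ⟩
      q ^ (d * r) * q ^ (ρ * d)   ∎

  bernoulli : ∀ q j → q ^ j * (q + j) ≤ suc q ^ j * q
  bernoulli q zero    = ≤-reflexive (cong (1 *_) (+-identityʳ q))
  bernoulli q (suc j) = begin
    q * q ^ j * (q + suc j)      ≤⟨ m≤m+n _ (q ^ j * j) ⟩
    q * q ^ j * (q + suc j) + q ^ j * j  ≡⟨ expand q (q ^ j) j ⟩
    suc q * (q ^ j * (q + j))    ≤⟨ *-monoʳ-≤ (suc q) (bernoulli q j) ⟩
    suc q * (suc q ^ j * q)      ≡⟨ sym (*-assoc (suc q) (suc q ^ j) q) ⟩
    suc q ^ suc j * q            ∎
    where
    open ≤-Reasoning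
    expand : ∀ q x j → q * x * (q + suc j) + x * j ≡ suc q * (x * (q + j))
    expand = solve-∀

  -- The part `t * L * r` of the exponent already yields at least ((21/20)^L)^r > (4q)^r; the
  -- surplus `e′` only helps.
  growth : ∀ t L r e → 0 < t → 0 < r → let q = 20 * t in 4 * q * 20 ^ L < 21 ^ L → t * L * r ≤ e →
           (4 * q) ^ r * q ^ e < suc q ^ e
  growth t L r e 0<t 0<r 4q<b^L tLr≤e = begin-strict
    (4 * q) ^ r * q ^ e                             ≡⟨ cong (λ x → (4 * q) ^ r * q ^ x) (sym e≡) ⟩
    (4 * q) ^ r * q ^ (t * L * r + e′)              ≡⟨ cong ((4 * q) ^ r *_) (^-distribˡ-+-* q (t * L * r) e′) ⟩
    (4 * q) ^ r * (q ^ (t * L * r) * q ^ e′)        ≡⟨ sym (*-assoc ((4 * q) ^ r) _ _) ⟩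
    (4 * q) ^ r * q ^ (t * L * r) * q ^ e′
      ≡⟨ cong (_* q ^ e′) (trans (cong ((4 * q) ^ r *_) (sym (^-*-assoc q (t * L) r))) (sym (^-distribʳ-* r (4 * q) _))) ⟩
    (4 * q * q ^ (t * L)) ^ r * q ^ e′
      <⟨ *-monoˡ-< (q ^ e′) {{^-pos 0<q e′}} (^-monoˡ-< r {{ℕ.>-nonZero 0<r}} base) ⟩
    (suc q ^ (t * L)) ^ r * q ^ e′                  ≤⟨ *-monoʳ-≤ ((suc q ^ (t * L)) ^ r) (^-monoˡ-≤ e′ (n≤1+n q)) ⟩
    (suc q ^ (t * L)) ^ r * suc q ^ e′              ≡⟨ cong (_* suc q ^ e′) (^-*-assoc (suc q) (t * L) r) ⟩
    suc q ^ (t * L * r) * suc q ^ e′                ≡⟨ sym (^-distribˡ-+-* (suc q) (t * L * r) e′) ⟩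
    suc q ^ (t * L * r + e′)                        ≡⟨ cong (suc q ^_) e≡ ⟩
    suc q ^ e                                       ∎
    where
    open ≤-Reasoning
    q = 20 * t
    e′ = e ∸ t * L * r
    e≡ : t * L * r + e′ ≡ e
    e≡ = m+[n∸m]≡n tLr≤e
    0<q : 0 < q
    0<q = *-mono-≤ (s≤s (z≤n {19})) 0<t
    factor : ∀ t x → t * (x * 21) ≡ x * (20 * t + t)
    factor = solve-∀
    factor′ : ∀ t x → x * (20 * t) ≡ t * (x * 20)
    factor′ = solve-∀
    one : q ^ t * 21 ≤ suc q ^ t * 20
    one = *-cancelˡ-≤ t {{ℕ.>-nonZero 0<t}} (≤-trans (≤-reflexive (factor t (q ^ t)))
            (≤-trans (bernoulli q t) (≤-reflexive (factor′ t (suc q ^ t)))))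
    powers : q ^ (t * L) * 21 ^ L ≤ suc q ^ (t * L) * 20 ^ L
    powers = begin
      q ^ (t * L) * 21 ^ L      ≡⟨ cong (_* 21 ^ L) (sym (^-*-assoc q t L)) ⟩
      (q ^ t) ^ L * 21 ^ L      ≡⟨ sym (^-distribʳ-* L (q ^ t) 21) ⟩
      (q ^ t * 21) ^ L          ≤⟨ ^-monoˡ-≤ L one ⟩
      (suc q ^ t * 20) ^ L      ≡⟨ ^-distribʳ-* L (suc q ^ t) 20 ⟩
      (suc q ^ t) ^ L * 20 ^ L  ≡⟨ cong (_* 20 ^ L) (^-*-assoc (suc q) t L) ⟩
      suc q ^ (t * L) * 20 ^ L  ∎
    rotate : ∀ a b c → a * b * c ≡ b * (a * c)
    rotate = solve-∀
    base : 4 * q * q ^ (t * L) < suc q ^ (t * L)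
    base = *-cancelʳ-< (20 ^ L) _ _ (begin-strict
      4 * q * q ^ (t * L) * 20 ^ L    ≡⟨ rotate (4 * q) (q ^ (t * L)) (20 ^ L) ⟩
      q ^ (t * L) * (4 * q * 20 ^ L)  <⟨ *-monoʳ-< (q ^ (t * L)) {{^-pos 0<q (t * L)}} 4q<b^L ⟩
      q ^ (t * L) * 21 ^ L            ≤⟨ powers ⟩
      suc q ^ (t * L) * 20 ^ L        ∎)

  -- 406 = 29·28/2 is the total penalty of 30 blocks.
  sparse-digraph : ∀ μ L d g → 0 < μ → 0 < d → 4 * (20 * (30 * μ)) * 20 ^ L < 21 ^ L → 30 * μ * L * 30 ≤ 406 * d →
    Σ Digraph λ D → GirthAtLeast D g × MaxDegreeAtMost D (3 * d) × (∀ k → k ≤ 10 * μ → ¬ AcyclicColouring D k)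
  sparse-digraph μ L d g 0<μ 0<d 4q<b^L exponent =
    let D , girth , degree , dead = Construction.Start.conclusion N d 30 m q g refl 2m<n 0<d ≤-refl r≤q
          (few-configs (10 * μ) 30 d (*-mono-≤ (s≤s (z≤n {9})) 0<μ) z<s
            (subst (λ q → (4 * q) ^ 30 * q ^ (406 * d) < suc q ^ (406 * d)) (q≡ μ)
              (growth (30 * μ) L 30 (406 * d) (*-mono-≤ (s≤s (z≤n {29})) 0<μ) z<s 4q<b^L exponent)))
    in D , girth , degree , λ k k≤ → dead k (≤-trans (*-monoˡ-≤ 2 (*-monoˡ-≤ (30 * m) k≤)) (≤-reflexive (half μ m)))
    where
    -- Equal to 20·(30μ), as `growth` wants, and of the form 2Kr with K = 10μ for counting systems.
    -- Then N/(2·30m) = 10μ is the number of colours excluded.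
    q = 2 * (10 * μ) * 30
    m = suc (3 * d) ^ suc g
    N = q * m
    q≡ : ∀ μ → 20 * (30 * μ) ≡ 2 * (10 * μ) * 30
    q≡ = solve-∀
    half : ∀ μ m → 10 * μ * (30 * m) * 2 ≡ 2 * (10 * μ) * 30 * m
    half = solve-∀
    q≡600μ : ∀ μ → 600 * μ ≡ 2 * (10 * μ) * 30
    q≡600μ = solve-∀
    600≤q : 600 ≤ q
    600≤q = ≤-trans (*-monoʳ-≤ 600 0<μ) (≤-reflexive (q≡600μ μ))
    r≤q : 30 ≤ q
    r≤q = ≤-trans (m≤m+n 30 570) 600≤q
    2m<n : 2 * m < N
    2m<n = *-monoˡ-< m {{m^n≢0 (suc (3 * d)) (suc g)}} (≤-trans (m≤m+n 3 597) 600≤q)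

  -- Choice of the parameters

  Realised : ℚᵘ → ℕ → ℕ → Set
  Realised a g Δ = Σ Digraph λ D → GirthAtLeast D g × MaxDegreeAtMost D Δ × ChiAtLeastALog D a Δ

  crossing : ∀ {P : ℕ → Set} → (∀ j → P j ⊎ ¬ P j) → ¬ P 0 → ∀ J → P J → ∃ λ j → ¬ P j × P (suc j)
  crossing dec ¬P0 zero    PJ = contradiction PJ ¬P0
  crossing dec ¬P0 (suc J) PJ with dec J
  ... | inj₁ p  = crossing dec ¬P0 J p
  ... | inj₂ ¬p = J , ¬p , PJ

  -- `L` is the integer part of the logarithm of Δ. The search may stop at 20Δ, since Bernoulli's
  -- inequality gives (21/20)^(20Δ) ≥ 1 + Δ.
  log-21/20 : ∀ Δ → 1 ≤ Δ → ∃ λ L → 21 ^ L ≤ Δ * 20 ^ L × Δ * 20 ^ suc L < 21 ^ suc L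
  log-21/20 Δ 1≤Δ = let L , below , above = crossing dec (λ lt → <⇒≱ lt (≤-trans 1≤Δ (≤-reflexive (sym (*-identityʳ Δ))))) (20 * Δ) top
                    in L , ≮⇒≥ below , above
    where
    dec : ∀ j → Δ * 20 ^ j < 21 ^ j ⊎ ¬ (Δ * 20 ^ j < 21 ^ j)
    dec j with Δ * 20 ^ j <? 21 ^ j
    ... | yes p = inj₁ p
    ... | no ¬p = inj₂ ¬p
    regroup : ∀ Δ x → 20 * (suc Δ * x) ≡ x * (20 + 20 * Δ)
    regroup = solve-∀
    top : Δ * 20 ^ (20 * Δ) < 21 ^ (20 * Δ)
    top = ≤-trans (+-monoˡ-≤ (Δ * 20 ^ (20 * Δ)) (m^n>0 20 (20 * Δ)))
      (*-cancelˡ-≤ 20 (≤-trans (≤-reflexive (regroup Δ (20 ^ (20 * Δ))))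
        (≤-trans (bernoulli 20 (20 * Δ)) (≤-reflexive (*-comm (21 ^ (20 * Δ)) 20)))))

  110L≤b^L : ∀ i → 110 * (i + 400) * 20 ^ (i + 400) ≤ 21 ^ (i + 400)
  110L≤b^L zero    = ≤ᵇ⇒≤ _ _ tt
  110L≤b^L (suc i) = begin
    110 * suc L * (20 * X)          ≤⟨ m≤m+n _ (110 * i * X + 41800 * X) ⟩
    110 * suc L * (20 * X) + (110 * i * X + 41800 * X)  ≡⟨ regroup i X ⟩
    21 * (110 * L * X)              ≤⟨ *-monoʳ-≤ 21 (110L≤b^L i) ⟩
    21 * 21 ^ L                     ∎
    where
    open ≤-Reasoning
    L = i + 400
    X = 20 ^ (i + 400)
    regroup : ∀ i x → 110 * suc (i + 400) * (20 * x) + (110 * i * x + 41800 * x) ≡ 21 * (110 * (i + 400) * x)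
    regroup = solve-∀

  -- Large maximum degree

  module LargeDegree (g Δ : ℕ) (large : 21 ^ 400 ≤ Δ) where

    0<Δ : 0 < Δ
    0<Δ = ≤-trans (m^n>0 21 400) large

    L : ℕ
    L = proj₁ (log-21/20 Δ 0<Δ)

    b^L≤Δ : 21 ^ L ≤ Δ * 20 ^ L
    b^L≤Δ = proj₁ (proj₂ (log-21/20 Δ 0<Δ))

    Δ<b^[1+L] : Δ * 20 ^ suc L < 21 ^ suc L
    Δ<b^[1+L] = proj₂ (proj₂ (log-21/20 Δ 0<Δ))

    400≤L : 400 ≤ L
    400≤L = ≮⇒≥ λ L<400 → <⇒≱ Δ<b^[1+L] (≤-trans (^-monoʳ-≤ 21 L<400)
      (≤-trans large (m≤m*n Δ (20 ^ suc L) {{m^n≢0 20 (suc L)}})))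

    110L≤Δ : 110 * L ≤ Δ
    110L≤Δ = *-cancelʳ-≤ (110 * L) Δ (20 ^ L) {{m^n≢0 20 L}}
      (≤-trans (subst (λ L → 110 * L * 20 ^ L ≤ 21 ^ L) (m∸n+n≡m 400≤L) (110L≤b^L (L ∸ 400))) b^L≤Δ)

    d : ℕ
    d = Δ / 3

    3d≤Δ : 3 * d ≤ Δ
    3d≤Δ = ≤-trans (≤-reflexive (*-comm 3 d)) (m/n*n≤m Δ 3)

    Δ≤3d+2 : Δ ≤ 3 * d + 2
    Δ≤3d+2 = ≤-trans (≤-reflexive (m≡m%n+[m/n]*n Δ 3)) (≤-trans (+-monoˡ-≤ (d * 3) (ℕ.s≤s⁻¹ (m%n<n Δ 3)))
      (≤-reflexive (trans (+-comm 2 (d * 3)) (cong (_+ 2) (*-comm d 3)))))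

    instance
      20L≢0 : NonZero (20 * L)
      20L≢0 = ℕ.>-nonZero (*-mono-≤ (s≤s (z≤n {19})) (≤-trans (s≤s z≤n) 400≤L))

    -- Solves the exponent condition 900μL ≤ 406d with 405 = 45·9 in place of 406, which gives the
    -- round ratio 9/20.
    μ : ℕ
    μ = 9 * d / (20 * L)

    20Lμ≤9d : μ * (20 * L) ≤ 9 * d
    20Lμ≤9d = m/n*n≤m (9 * d) (20 * L)

    9d≤20Lμ+20L : 9 * d ≤ 20 * L + μ * (20 * L)
    9d≤20Lμ+20L = ≤-trans (≤-reflexive (m≡m%n+[m/n]*n (9 * d) (20 * L)))
      (+-monoˡ-≤ (μ * (20 * L)) (<⇒≤ (m%n<n (9 * d) (20 * L))))

    330L≤9d+6 : 330 * L ≤ 9 * d + 6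
    330L≤9d+6 = begin
      330 * L          ≡⟨ *-assoc 3 110 L ⟩
      3 * (110 * L)    ≤⟨ *-monoʳ-≤ 3 (≤-trans 110L≤Δ Δ≤3d+2) ⟩
      3 * (3 * d + 2)  ≡⟨ expand d ⟩
      9 * d + 6        ∎
      where
      open ≤-Reasoning
      expand : ∀ d → 3 * (3 * d + 2) ≡ 9 * d + 6
      expand = solve-∀

    270L+84≤9d : 270 * L + 84 ≤ 9 * d
    270L+84≤9d = +-cancelʳ-≤ 6 _ _ (begin
      270 * L + 84 + 6   ≡⟨ +-assoc (270 * L) 84 6 ⟩
      270 * L + 90       ≤⟨ +-monoʳ-≤ (270 * L) (≤-trans (m≤m+n 90 310) (≤-trans 400≤L (m≤n*m L 60))) ⟩
      270 * L + 60 * L   ≡⟨ sym (*-distribʳ-+ L 270 60) ⟩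
      330 * L            ≤⟨ 330L≤9d+6 ⟩
      9 * d + 6          ∎)
      where open ≤-Reasoning

    0<d : 0 < d
    0<d = n≢0⇒n>0 λ d≡0 → contradiction
      (≤-trans (≤-trans (m≤n+m 84 (270 * L)) 270L+84≤9d) (≤-reflexive (cong (9 *_) d≡0))) λ ()

    0<μ : 0 < μ
    0<μ = n≢0⇒n>0 λ μ≡0 → <⇒≱ (begin-strict
      20 * L + μ * (20 * L)  ≡⟨ trans (cong (λ μ → 20 * L + μ * (20 * L)) μ≡0) (+-identityʳ (20 * L)) ⟩
      20 * L                 ≤⟨ *-monoˡ-≤ L (m≤m+n 20 250) ⟩
      270 * L                <⟨ m<m+n (270 * L) z<s ⟩
      270 * L + 84           ≤⟨ 270L+84≤9d ⟩
      9 * d                  ∎) 9d≤20Lμ+20L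
      where open ≤-Reasoning

    -- This is 21·4q ≤ 20Δ; the factor 21/20 is lost because Δ is only known to lie below the power
    -- with exponent L + 1. From L ≥ 400 follows μ ≤ 9d/8000, so 4q = 2400μ is at most 0.9Δ.
    50400μ≤20Δ : 50400 * μ ≤ 20 * Δ
    50400μ≤20Δ = *-cancelˡ-≤ 10 (begin
      10 * (50400 * μ)       ≡⟨ left μ ⟩
      63 * (μ * (20 * 400))  ≤⟨ *-monoʳ-≤ 63 (≤-trans (*-monoʳ-≤ μ (*-monoʳ-≤ 20 400≤L)) 20Lμ≤9d) ⟩
      63 * (9 * d)           ≡⟨ right d ⟩
      189 * (3 * d)          ≤⟨ *-monoʳ-≤ 189 3d≤Δ ⟩
      189 * Δ                ≤⟨ *-monoˡ-≤ Δ (m≤m+n 189 11) ⟩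
      200 * Δ                ≡⟨ *-assoc 10 20 Δ ⟩
      10 * (20 * Δ)          ∎)
      where
      open ≤-Reasoning
      left : ∀ μ → 10 * (50400 * μ) ≡ 63 * (μ * 8000)
      left = solve-∀
      right : ∀ d → 63 * (9 * d) ≡ 189 * (3 * d)
      right = solve-∀

    4q<b^L : 4 * (20 * (30 * μ)) * 20 ^ L < 21 ^ L
    4q<b^L = *-cancelˡ-< 21 _ _ (begin-strict
      21 * (4 * (20 * (30 * μ)) * 20 ^ L)  ≡⟨ left μ (20 ^ L) ⟩
      50400 * μ * 20 ^ L                   ≤⟨ *-monoˡ-≤ (20 ^ L) 50400μ≤20Δ ⟩
      20 * Δ * 20 ^ L                      ≡⟨ right Δ (20 ^ L) ⟩
      Δ * (20 * 20 ^ L)                    <⟨ Δ<b^[1+L] ⟩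
      21 * 21 ^ L                          ∎)
      where
      open ≤-Reasoning
      left : ∀ μ x → 21 * (4 * (20 * (30 * μ)) * x) ≡ 50400 * μ * x
      left = solve-∀
      right : ∀ Δ x → 20 * Δ * x ≡ Δ * (20 * x)
      right = solve-∀

    exponent : 30 * μ * L * 30 ≤ 406 * d
    exponent = begin
      30 * μ * L * 30      ≡⟨ left μ L ⟩
      45 * (μ * (20 * L))  ≤⟨ *-monoʳ-≤ 45 20Lμ≤9d ⟩
      45 * (9 * d)         ≡⟨ sym (*-assoc 45 9 d) ⟩
      405 * d              ≤⟨ *-monoˡ-≤ d (n≤1+n 405) ⟩
      406 * d              ∎
      where
      open ≤-Reasoning
      left : ∀ μ L → 30 * μ * L * 30 ≡ 45 * (μ * (20 * L))
      left = solve-∀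

    -- Without rounding, 10μ would be 3Δ/(2L) and the right side at least 22.5Δ. The slack of 1.5Δ
    -- pays for rounding down d and μ, whose cost is of order L; hence the need for `110L≤Δ`.
    21Δ≤15L[10μ+1] : Δ * 21 ≤ L * (15 * suc (10 * μ))
    21Δ≤15L[10μ+1] = *-cancelˡ-≤ 2 (+-cancelʳ-≤ (300 * L) _ _ (begin
      2 * (Δ * 21) + 300 * L                     ≡⟨ cong (_+ 300 * L) (e₁ Δ) ⟩
      42 * Δ + 300 * L                           ≤⟨ +-monoˡ-≤ (300 * L) (*-monoʳ-≤ 42 Δ≤3d+2) ⟩
      42 * (3 * d + 2) + 300 * L                 ≡⟨ e₂ d L ⟩
      126 * d + 30 * L + (270 * L + 84)          ≤⟨ +-monoʳ-≤ (126 * d + 30 * L) 270L+84≤9d ⟩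
      126 * d + 30 * L + 9 * d                   ≡⟨ e₃ d L ⟩
      15 * (9 * d) + 30 * L                      ≤⟨ +-monoˡ-≤ (30 * L) (*-monoʳ-≤ 15 9d≤20Lμ+20L) ⟩
      15 * (20 * L + μ * (20 * L)) + 30 * L      ≡⟨ e₄ L μ ⟩
      2 * (L * (15 * suc (10 * μ))) + 300 * L    ∎))
      where
      open ≤-Reasoning
      e₁ : ∀ Δ → 2 * (Δ * 21) ≡ 42 * Δ
      e₁ = solve-∀
      e₂ : ∀ d L → 42 * (3 * d + 2) + 300 * L ≡ 126 * d + 30 * L + (270 * L + 84)
      e₂ = solve-∀
      e₃ : ∀ d L → 126 * d + 30 * L + 9 * d ≡ 15 * (9 * d) + 30 * L
      e₃ = solve-∀
      e₄ : ∀ L μ → 15 * (20 * L + μ * (20 * L)) + 30 * L ≡ 2 * (L * (15 * suc (10 * μ))) + 300 * L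
      e₄ = solve-∀

    realised : Realised (1/suc 14) g Δ
    realised = let D , girth , degree , notCol = sparse-digraph μ L d g 0<μ 0<d 4q<b^L exponent
               in D , girth , (λ v → ≤-trans (degree v) 3d≤Δ) , chi D notCol
      where
      chi : ∀ D → (∀ k → k ≤ 10 * μ → ¬ AcyclicColouring D k) → ChiAtLeastALog D (1/suc 14) Δ
      chi D notCol zero    col = contradiction col (notCol 0 z≤n)
      chi D notCol (suc k) col = ExpAtMost-power 20 L z<s (ratio-nonNeg 14 Δ k)
        (ratio-≤ 14 Δ k L 20 (≤-trans 21Δ≤15L[10μ+1] (*-monoʳ-≤ L (*-monoʳ-≤ 15 (≰⇒> λ le → notCol (suc k) le col)))))
        b^L≤Δ

  -- Small maximum degree and the absolute constant

  point : Digraph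
  point = record { n = 1 ; arc = λ _ _ → false ; loopless = λ _ → refl }

  -- With a ≤ 1/(2Δ) the quotient aΔ/k is at most 1/2 for every k ≥ 1, and exp(1/2) ≤ 2 ≤ Δ; a
  -- single vertex suffices.
  point-realised : ∀ s g Δ → 2 ≤ Δ → 2 * Δ ≤ suc s → Realised (1/suc s) g Δ
  point-realised s g Δ 2≤Δ 2Δ≤ = point , (noDigon , noCycle) , (λ _ → z≤n) , chi
    where
    noDigon : 2 < g → ¬ Digon point
    noDigon _ (_ , _ , _ , () , _)
    noCycle : ∀ m → 3 + m < g → ¬ UCycle point m
    noCycle m _ (f , _ , adj , _) with adj zero
    ... | inj₁ ()
    ... | inj₂ ()
    chi : ChiAtLeastALog point (1/suc s) Δ
    chi zero    (col , _) = contradiction (col zero) λ ()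
    chi (suc k) _ = ExpAtMost-power 1 1 z<s (ratio-nonNeg s Δ k) (ratio-≤ s Δ k 1 1
      (≤-trans (≤-reflexive (*-comm Δ 2)) (≤-trans 2Δ≤ (≤-trans (m≤m*n (suc s) (suc k)) (≤-reflexive (sym (*-identityˡ _)))))))
      (≤-trans 2≤Δ (≤-reflexive (sym (*-identityʳ Δ))))

  Realised-antitone : ∀ {s t g Δ} → s ≤ t → Realised (1/suc s) g Δ → Realised (1/suc t) g Δ
  Realised-antitone {s} {t} {g} {Δ} s≤t (D , girth , degree , chi) = D , girth , degree , chi′
    where
    chi′ : ChiAtLeastALog D (1/suc t) Δ
    chi′ zero    col = chi zero col
    chi′ (suc k) col N = ℚᵘ.≤-trans (expPartial-mono (ratio-nonNeg t Δ k)
      (*-monoˡ {1/suc t ℚᵘ.* ι Δ} {1/suc s ℚᵘ.* ι Δ} (fraction-nonNeg 1 k)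
        (*-monoˡ {1/suc t} {1/suc s} (fraction-nonNeg Δ 0) (fraction-≤ (*-monoʳ-≤ 1 (s≤s s≤t)))))
      N) (chi (suc k) col N)

  small-constant : ∀ Δ₀ → (∀ g Δ → 1 ≤ g → Δ₀ ≤ Δ → Realised (1/suc 14) g Δ) →
    Σ ℚᵘ λ a → 0ℚᵘ ℚᵘ.< a × (∀ g Δ → 1 ≤ g → 2 ≤ Δ → Realised a g Δ)
  small-constant Δ₀ large = 1/suc s , ℚᵘ.positive⁻¹ (1/suc s) , λ g Δ 1≤g 2≤Δ → case g Δ 1≤g 2≤Δ (≤-total Δ₀ Δ)
    where
    -- The constant 1/(s+1) has to be at most 1/15 for large degrees and at most 1/(2Δ) for every Δ
    -- ≤ Δ₀.
    s = 2 * Δ₀ + 14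
    case : ∀ g Δ → 1 ≤ g → 2 ≤ Δ → Δ₀ ≤ Δ ⊎ Δ ≤ Δ₀ → Realised (1/suc s) g Δ
    case g Δ 1≤g 2≤Δ (inj₁ Δ₀≤Δ) = Realised-antitone (m≤n+m 14 (2 * Δ₀)) (large g Δ 1≤g Δ₀≤Δ)
    case g Δ 1≤g 2≤Δ (inj₂ Δ≤Δ₀) = point-realised s g Δ 2≤Δ
      (≤-trans (*-monoʳ-≤ 2 Δ≤Δ₀) (≤-trans (m≤m+n (2 * Δ₀) 14) (n≤1+n _)))

  large-degree : ∃ λ Δ₀ → ∀ g Δ → 1 ≤ g → Δ₀ ≤ Δ → Realised (1/suc 14) g Δ
  large-degree = 21 ^ 400 , λ g Δ _ large → LargeDegree.realised g Δ large

open import Data.Nat using (ℕ; _≤_)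
open import Data.Integer using (+_)
open import Data.Product using (Σ; _×_; ∃; _,_; proj₁; proj₂)
open import Data.Rational.Unnormalised using (ℚᵘ; mkℚᵘ; 0ℚᵘ; _<_)
open Digraphs using (small-constant; large-degree)

theorem1 : (Σ ℚᵘ λ a → 0ℚᵘ < a ×
    (∀ (g Δ : ℕ) → 1 ≤ g → 2 ≤ Δ →
    Σ Digraph λ D → GirthAtLeast D g × MaxDegreeAtMost D Δ × ChiAtLeastALog D a Δ))
    ×
    (∃ λ (Δ₀ : ℕ) → ∀ (g Δ : ℕ) → 1 ≤ g → Δ₀ ≤ Δ →
    Σ Digraph λ D → GirthAtLeast D g × MaxDegreeAtMost D Δ × ChiAtLeastALog D (mkℚᵘ (+ 1) 14) Δ)
theorem1 = small-constant (proj₁ large-degree) (proj₂ large-degree) , large-degree
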